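{- Let $(X,\mathcal{R})$ be a commutative $d$-class association scheme and let $\mathbf{x}\in\mathbb{Q}^X$ be a nonzero vector (the characteristic vector of a nonempty subset $C\subseteq X$, or more generally of a rationally weighted subset $C$), with inner distribution $a=[a_0,\ldots,a_d]$, $a_i=\mathbf{x}^\top A_i\mathbf{x}/\mathbf{x}^\top\mathbf{x}$, and let $T(C)=\{j: E_j\mathbf{x}=0\}$. Then: (i) if $j\in T(C)$ and $\sigma\in\Sigma_\mathbb{Q}$, then $j^\sigma\in T(C)$; hence $T(C)$ is a union of orbits $\mathcal{Q}_j\in\{\mathcal{Q}_1,\ldots,\mathcal{Q}_e\}$; (ii) if $\iota(i)=\iota(j)$ and $aQ_i=0$, then $aQ_j=0$; equivalently, if $E_i\mathbf{x}=0$ then $E_j\mathbf{x}=0$; (iii) if $aQ_i=0$ then $a\overline{Q}_{\iota(i)}=0$; equivalently, if $E_i\mathbf{x}=0$ then $F_{\iota(i)}\mathbf{x}=0$. Here $Q_i$ denotes column $i$ of $Q$ and $\overline{Q}_\ell$ column $\ell$ of $\overline{Q}$.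
   Context: A (commutative) association scheme is a pair $(X,\mathcal{R})$ with $X$ a nonempty finite set and $\mathcal{R}=\{R_0,\ldots,R_d\}$ a partition of $X\times X$ such that $R_0$ is the identity relation, each transpose $R_i^\top$ is some $R_{i'}$, and there are numbers $p_{ij}^k=p_{ji}^k$ such that for every $(a,b)\in R_k$ the number of $c$ with $(a,c)\in R_i$, $(c,b)\in R_j$ is $p_{ij}^k$. Its adjacency matrices $A_0,\ldots,A_d$ are the $0/1$ matrices of the $R_i$; their complex span has a unique basis of primitive idempotents $E_0,\ldots,E_d$ ($E_iE_j=\delta_{ij}E_i$, $\sum_jE_j=I$, $E_0=\frac1{|X|}J$). The second eigenmatrix $Q=[Q_{ij}]_{i,j=0}^d$ is defined by $E_j=\frac1{|X|}\sum_{i=0}^dQ_{ij}A_i$. The splitting field $\mathbb{F}$ is $\mathbb{Q}$ with all eigenvalues of $A_1,\ldots,A_d$ adjoined. Each $\boldsymbol\sigma\in\mathrm{Gal}(\mathbb{F}/\mathbb{Q})$, applied entrywise, maps $E_j$ to a primitive idempotent $E_{j^\sigma}$, defining a permutation $\sigma$ of $\{0,\ldots,d\}$; $\Sigma_\mathbb{Q}$ is the group of these permutations. Let $\mathcal{Q}_0=\{0\},\mathcal{Q}_1,\ldots,\mathcal{Q}_e$ be the orbits of $\Sigma_\mathbb{Q}$ on $\{0,\ldots,d\}$, define $\iota:\{0,\ldots,d\}\to\{0,\ldots,e\}$ by $\iota(i)=\ell$ if $i\in\mathcal{Q}_\ell$, let $F_\ell=\sum_{i\in\mathcal{Q}_\ell}E_i$,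 and let $\overline{Q}=QO$ where $O$ is the $(d+1)\times(e+1)$ matrix with $O_{i\ell}=1$ if $i\in\mathcal{Q}_\ell$ and $0$ otherwise. A (possibly weighted) subset $C$ with vector $\mathbf{x}$ is a Delsarte $T$-design if $E_j\mathbf{x}=0$ for all $j\in T$.
   Formalization: In (i), T(C) is shown to be a union of orbits, and the orbit {0} is excluded only when the entries of x do not sum to 0; if they sum to 0 (e.g. x=(1,-1) on two points), then E_0x=0, so 0 lies in T(C) and the claim as worded fails. -}

module Defs where

open import Level using (0ℓ)
open import Algebra.Bundles using (RawRing)
open import Algebra.Definitions.RawMonoid using (sum)
open import Algebra.Morphism.Structures using (module RingMorphisms)
open import Data.Bool.Base using (if_then_else_)
open import Data.Fin.Base using (Fin; zero; suc)
open import Data.Fin.Permutation using (Permutation′; _⟨$⟩ʳ_)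
open import Data.Fin.Properties using (_≟_)
open import Data.Integer.Base using (1ℤ)
open import Data.List.Base using (length; filter; allFin)
open import Data.Nat.Base as ℕ using (ℕ; suc; _≥_)
import Data.Nat.Properties as ℕ
open import Data.Product.Base using (Σ; ∃; ∃₂; _×_; _,_; proj₁; proj₂)
open import Data.Rational.Base as ℚ using (ℚ; 0ℚ; 1ℚ; ½; ∣_∣; _/_; _÷_)
import Data.Rational.Properties as ℚ
open import Data.Rational.Solver using (module +-*-Solver)
open import Data.Sum.Base using (inj₁; inj₂)
open import Data.Vec.Functional using (Vector)
open import Function.Bundles using (_⇔_)
open import Function.Definitions using (Surjective)
open import Relation.Binary.PropositionalEquality using (_≡_; _≢_; refl; sym; trans; cong; subst)
open import Relation.Nullary using (¬_; yes; no; does)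
open import Relation.Nullary.Decidable using (_×-dec_)
open import Relation.Unary using (Pred; _∈_)

-- The real numbers, as Cauchy sequences of rationals.
module Real where

  record ℝ : Set where
    no-eta-equality
    field
      seq    : ℕ → ℚ
      cauchy : ∀ ε → 0ℚ ℚ.< ε →
               ∃ λ N → ∀ m n → m ≥ N → n ≥ N → ∣ seq m ℚ.- seq n ∣ ℚ.< ε

  open ℝ public

  infix  8 -_
  infixl 7 _*_
  infixl 6 _+_
  infix  4 _≈_

  record _≈_ (x y : ℝ) : Set where
    constructor mk≈
    field
      null : ∀ ε → 0ℚ ℚ.< ε →
             ∃ λ N → ∀ n → n ≥ N → ∣ seq x n ℚ.- seq y n ∣ ℚ.< ε

  open _≈_ public

  fromℚ : ℚ → ℝ
  fromℚ q .seq _ = q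
  fromℚ q .cauchy ε ε>0 = 0 , λ _ _ _ _ →
    subst (ℚ._< ε) (sym (cong ∣_∣ (ℚ.+-inverseʳ q))) ε>0

  private
    half-pos : ∀ {ε} → 0ℚ ℚ.< ε → 0ℚ ℚ.< ½ ℚ.* ε
    half-pos {ε} ε>0 =
      ℚ.positive⁻¹ (½ ℚ.* ε) {{ℚ.pos*pos⇒pos ½ ε {{ℚ.positive ε>0}}}}

    half+half : ∀ ε → ½ ℚ.* ε ℚ.+ ½ ℚ.* ε ≡ ε
    half+half ε = trans (sym (ℚ.*-distribʳ-+ ε ½ ½)) (ℚ.*-identityˡ ε)

    +-rearrange : ∀ a b c d → (a ℚ.+ b) ℚ.- (c ℚ.+ d) ≡ (a ℚ.- c) ℚ.+ (b ℚ.- d)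
    +-rearrange = solve 4 (λ a b c d →
      (a :+ b) :- (c :+ d) := (a :- c) :+ (b :- d)) refl
      where open +-*-Solver

    *-rearrange : ∀ a b c d →
      (a ℚ.* b) ℚ.- (c ℚ.* d) ≡ a ℚ.* (b ℚ.- d) ℚ.+ d ℚ.* (a ℚ.- c)
    *-rearrange = solve 4 (λ a b c d →
      (a :* b) :- (c :* d) := a :* (b :- d) :+ d :* (a :- c)) refl
      where open +-*-Solver

    neg-rearrange : ∀ a b → (ℚ.- a) ℚ.- (ℚ.- b) ≡ ℚ.- (a ℚ.- b)
    neg-rearrange = solve 2 (λ a b → (:- a) :- (:- b) := :- (a :- b)) refl
      where open +-*-Solver

    split : ∀ a b → a ≡ b ℚ.+ (a ℚ.- b)
    split = solve 2 (λ a b → a := b :+ (a :- b)) refl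
      where open +-*-Solver

    bound : (x : ℝ) → ∃₂ λ N B → 0ℚ ℚ.< B × (∀ n → n ≥ N → ∣ seq x n ∣ ℚ.≤ B)
    bound x with cauchy x 1ℚ (ℚ.positive⁻¹ 1ℚ)
    ... | N , close = N , ∣ seq x N ∣ ℚ.+ 1ℚ
      , ℚ.+-mono-≤-< (ℚ.0≤∣p∣ (seq x N)) (ℚ.positive⁻¹ 1ℚ)
      , λ n n≥N → begin
        ∣ seq x n ∣                               ≡⟨ cong ∣_∣ (split (seq x n) (seq x N)) ⟩
        ∣ seq x N ℚ.+ (seq x n ℚ.- seq x N) ∣     ≤⟨ ℚ.∣p+q∣≤∣p∣+∣q∣ (seq x N) _ ⟩
        ∣ seq x N ∣ ℚ.+ ∣ seq x n ℚ.- seq x N ∣   ≤⟨ ℚ.+-monoʳ-≤ ∣ seq x N ∣ (ℚ.<⇒≤ (close n N n≥N ℕ.≤-refl)) ⟩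
        ∣ seq x N ∣ ℚ.+ 1ℚ                        ∎
      where open ℚ.≤-Reasoning

    product-small : ∀ {B ε} → 0ℚ ℚ.< B → 0ℚ ℚ.< ε →
      ∃ λ δ → 0ℚ ℚ.< δ × (∀ p q → ∣ p ∣ ℚ.≤ B → ∣ q ∣ ℚ.< δ → ∣ p ℚ.* q ∣ ℚ.< ε)
    product-small {B} {ε} B>0 ε>0 = δ , ℚ.positive⁻¹ δ , λ p q p≤B q<δ → begin-strict
      ∣ p ℚ.* q ∣        ≡⟨ ℚ.∣p*q∣≡∣p∣*∣q∣ p q ⟩
      ∣ p ∣ ℚ.* ∣ q ∣    ≤⟨ ℚ.*-monoʳ-≤-nonNeg ∣ q ∣ {{ℚ.∣-∣-nonNeg q}} p≤B ⟩
      B ℚ.* ∣ q ∣        <⟨ ℚ.*-monoʳ-<-pos B q<δ ⟩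
      B ℚ.* δ            ≡⟨ ℚ.*-assoc B _ ε ⟨
      B ℚ.* B⁻¹ ℚ.* ε    ≡⟨ cong (ℚ._* ε) (ℚ.*-inverseʳ B) ⟩
      1ℚ ℚ.* ε           ≡⟨ ℚ.*-identityˡ ε ⟩
      ε                  ∎
      where
      open ℚ.≤-Reasoning
      instance
        _ = ℚ.positive B>0
        _ = ℚ.positive ε>0
        _ = ℚ.pos⇒nonZero B
      B⁻¹ = ℚ.1/ B
      δ = B⁻¹ ℚ.* ε
      instance
        _ = ℚ.1/pos⇒pos B
        _ = ℚ.pos*pos⇒pos B⁻¹ ε

  _+_ : ℝ → ℝ → ℝ
  (x + y) .seq n = seq x n ℚ.+ seq y n
  (x + y) .cauchy ε ε>0 =
    let (N , xc) = cauchy x (½ ℚ.* ε) (half-pos ε>0)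
        (M , yc) = cauchy y (½ ℚ.* ε) (half-pos ε>0)
    in N ℕ.⊔ M , λ m n m≥ n≥ → begin-strict
      ∣ (seq x m ℚ.+ seq y m) ℚ.- (seq x n ℚ.+ seq y n) ∣
        ≡⟨ cong ∣_∣ (+-rearrange (seq x m) (seq y m) (seq x n) (seq y n)) ⟩
      ∣ (seq x m ℚ.- seq x n) ℚ.+ (seq y m ℚ.- seq y n) ∣
        ≤⟨ ℚ.∣p+q∣≤∣p∣+∣q∣ (seq x m ℚ.- seq x n) _ ⟩
      ∣ seq x m ℚ.- seq x n ∣ ℚ.+ ∣ seq y m ℚ.- seq y n ∣
        <⟨ ℚ.+-mono-< (xc m n (ℕ.m⊔n≤o⇒m≤o N M m≥) (ℕ.m⊔n≤o⇒m≤o N M n≥))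
                      (yc m n (ℕ.m⊔n≤o⇒n≤o N M m≥) (ℕ.m⊔n≤o⇒n≤o N M n≥)) ⟩
      ½ ℚ.* ε ℚ.+ ½ ℚ.* ε
        ≡⟨ half+half ε ⟩
      ε ∎
    where open ℚ.≤-Reasoning

  _*_ : ℝ → ℝ → ℝ
  (x * y) .seq n = seq x n ℚ.* seq y n
  (x * y) .cauchy ε ε>0 =
    let (N₁ , _ , B>0 , xb) = bound x
        (N₂ , _ , C>0 , yb) = bound y
        (δ , δ>0 , xs) = product-small B>0 (half-pos ε>0)
        (η , η>0 , ys) = product-small C>0 (half-pos ε>0)
        (N₃ , yc) = cauchy y δ δ>0
        (N₄ , xc) = cauchy x η η>0
        N₁₂ = N₁ ℕ.⊔ N₂
        N₃₄ = N₃ ℕ.⊔ N₄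
    in N₁₂ ℕ.⊔ N₃₄ , λ m n m≥ n≥ →
      let m≥₁₂ = ℕ.m⊔n≤o⇒m≤o N₁₂ N₃₄ m≥
          m≥₃₄ = ℕ.m⊔n≤o⇒n≤o N₁₂ N₃₄ m≥
          n≥₁₂ = ℕ.m⊔n≤o⇒m≤o N₁₂ N₃₄ n≥
          n≥₃₄ = ℕ.m⊔n≤o⇒n≤o N₁₂ N₃₄ n≥
      in begin-strict
      ∣ (seq x m ℚ.* seq y m) ℚ.- (seq x n ℚ.* seq y n) ∣
        ≡⟨ cong ∣_∣ (*-rearrange (seq x m) (seq y m) (seq x n) (seq y n)) ⟩
      ∣ seq x m ℚ.* (seq y m ℚ.- seq y n) ℚ.+ seq y n ℚ.* (seq x m ℚ.- seq x n) ∣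
        ≤⟨ ℚ.∣p+q∣≤∣p∣+∣q∣ (seq x m ℚ.* (seq y m ℚ.- seq y n)) _ ⟩
      ∣ seq x m ℚ.* (seq y m ℚ.- seq y n) ∣ ℚ.+ ∣ seq y n ℚ.* (seq x m ℚ.- seq x n) ∣
        <⟨ ℚ.+-mono-<
             (xs (seq x m) _ (xb m (ℕ.m⊔n≤o⇒m≤o N₁ N₂ m≥₁₂))
               (yc m n (ℕ.m⊔n≤o⇒m≤o N₃ N₄ m≥₃₄) (ℕ.m⊔n≤o⇒m≤o N₃ N₄ n≥₃₄)))
             (ys (seq y n) _ (yb n (ℕ.m⊔n≤o⇒n≤o N₁ N₂ n≥₁₂))
               (xc m n (ℕ.m⊔n≤o⇒n≤o N₃ N₄ m≥₃₄) (ℕ.m⊔n≤o⇒n≤o N₃ N₄ n≥₃₄))) ⟩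
      ½ ℚ.* ε ℚ.+ ½ ℚ.* ε
        ≡⟨ half+half ε ⟩
      ε ∎
    where open ℚ.≤-Reasoning

  -_ : ℝ → ℝ
  (- x) .seq n = ℚ.- seq x n
  (- x) .cauchy ε ε>0 =
    let (N , xc) = cauchy x ε ε>0
    in N , λ m n m≥ n≥ → subst (ℚ._< ε)
      (sym (trans (cong ∣_∣ (neg-rearrange (seq x m) (seq x n)))
                  (ℚ.∣-p∣≡∣p∣ (seq x m ℚ.- seq x n))))
      (xc m n m≥ n≥)

open Real using (ℝ)

record ℂ : Set where
  no-eta-equality
  field
    re im : ℝ

open ℂ public

infix  8 -_
infixl 7 _*_
infixl 6 _+_
infix  4 _≈_

record _≈_ (z w : ℂ) : Set where
  constructor mk≈
  field
    re-≈ : re z Real.≈ re w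
    im-≈ : im z Real.≈ im w

open _≈_ public

_+_ : ℂ → ℂ → ℂ
(z + w) .re = re z Real.+ re w
(z + w) .im = im z Real.+ im w

_*_ : ℂ → ℂ → ℂ
(z * w) .re = re z Real.* re w Real.+ Real.- (im z Real.* im w)
(z * w) .im = re z Real.* im w Real.+ im z Real.* re w

-_ : ℂ → ℂ
(- z) .re = Real.- re z
(- z) .im = Real.- im z

⟨_⟩ : ℚ → ℂ
⟨ q ⟩ .re = Real.fromℚ q
⟨ q ⟩ .im = Real.fromℚ 0ℚ

0ℂ 1ℂ : ℂ
0ℂ = ⟨ 0ℚ ⟩
1ℂ = ⟨ 1ℚ ⟩

ℂ-rawRing : RawRing 0ℓ 0ℓ
ℂ-rawRing = record
  { Carrier = ℂ ; _≈_ = _≈_ ; _+_ = _+_ ; _*_ = _*_ ; -_ = -_ ; 0# = 0ℂ ; 1# = 1ℂ }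

∑ : ∀ {n} → Vector ℂ n → ℂ
∑ = sum (RawRing.+-rawMonoid ℂ-rawRing)

∑ℚ : ∀ {n} → Vector ℚ n → ℚ
∑ℚ = sum ℚ.+-0-rawMonoid

Matrix : ℕ → ℕ → Set
Matrix m n = Fin m → Fin n → ℂ

infix 4 _≈ᵛ_ _≈ᴹ_

_≈ᵛ_ : ∀ {n} → Vector ℂ n → Vector ℂ n → Set
u ≈ᵛ v = ∀ a → u a ≈ v a

_≈ᴹ_ : ∀ {m n} → Matrix m n → Matrix m n → Set
M ≈ᴹ N = ∀ a b → M a b ≈ N a b

0ᵛ : ∀ {n} → Vector ℂ n
0ᵛ _ = 0ℂ

0ᴹ : ∀ {m n} → Matrix m n
0ᴹ _ _ = 0ℂ

Iᴹ : ∀ {n} → Matrix n n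
Iᴹ a b = if does (a ≟ b) then 1ℂ else 0ℂ

infixl 7 _*ᴹ_ _*ᵛ_ _ᵛ*_ _•ᴹ_

_*ᴹ_ : ∀ {l m n} → Matrix l m → Matrix m n → Matrix l n
(M *ᴹ N) a b = ∑ λ c → M a c * N c b

_*ᵛ_ : ∀ {m n} → Matrix m n → Vector ℂ n → Vector ℂ m
(M *ᵛ v) a = ∑ λ b → M a b * v b

_ᵛ*_ : ∀ {m n} → Vector ℂ m → Matrix m n → Vector ℂ n
(v ᵛ* M) b = ∑ λ a → v a * M a b

_•ᴹ_ : ∀ {m n} → ℂ → Matrix m n → Matrix m n
(c •ᴹ M) a b = c * M a b

∑ᴹ : ∀ {k m n} → (Fin k → Matrix m n) → Matrix m n
∑ᴹ B a b = ∑ λ i → B i a b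

⟨_⟩ᵛ : ∀ {n} → Vector ℚ n → Vector ℂ n
⟨ x ⟩ᵛ a = ⟨ x a ⟩

⟨_⟩ᴹ : ∀ {m n} → (Fin m → Fin n → ℚ) → Matrix m n
⟨ M ⟩ᴹ a b = ⟨ M a b ⟩

Span : ∀ {k m n} → (Fin k → Matrix m n) → Pred (Matrix m n) 0ℓ
Span {k} B M = ∃ λ (c : Vector ℂ k) → M ≈ᴹ ∑ᴹ (λ i → c i •ᴹ B i)

LinearlyIndependent : ∀ {k m n} → (Fin k → Matrix m n) → Set
LinearlyIndependent {k} B = ∀ (c : Vector ℂ k) → ∑ᴹ (λ i → c i •ᴹ B i) ≈ᴹ 0ᴹ → ∀ i → c i ≈ 0ℂ

Eigenvalue : ∀ {n} → Matrix n n → Pred ℂ 0ℓ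
Eigenvalue {n} M θ = ∃ λ (v : Vector ℂ n) → ¬ (v ≈ᵛ 0ᵛ) × (M *ᵛ v ≈ᵛ (λ a → θ * v a))

-- ℚ⟮ S ⟯ is the subfield of ℂ generated by S.
data ℚ⟮_⟯ (S : Pred ℂ 0ℓ) : Pred ℂ 0ℓ where
  rational  : ∀ q → ℚ⟮ S ⟯ ⟨ q ⟩
  generator : ∀ {z} → S z → ℚ⟮ S ⟯ z
  sum-mem   : ∀ {z w} → ℚ⟮ S ⟯ z → ℚ⟮ S ⟯ w → ℚ⟮ S ⟯ (z + w)
  prod-mem  : ∀ {z w} → ℚ⟮ S ⟯ z → ℚ⟮ S ⟯ w → ℚ⟮ S ⟯ (z * w)
  neg-mem   : ∀ {z} → ℚ⟮ S ⟯ z → ℚ⟮ S ⟯ (- z)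
  inv-mem   : ∀ {z w} → ℚ⟮ S ⟯ z → z * w ≈ 1ℂ → ℚ⟮ S ⟯ w
  resp-≈    : ∀ {z w} → ℚ⟮ S ⟯ z → z ≈ w → ℚ⟮ S ⟯ w

module _ (S : Pred ℂ 0ℓ) where

  ℚ⟮⟯-rawRing : RawRing 0ℓ 0ℓ
  ℚ⟮⟯-rawRing = record
    { Carrier = Σ ℂ ℚ⟮ S ⟯
    ; _≈_     = λ z w → proj₁ z ≈ proj₁ w
    ; _+_     = λ (z , p) (w , q) → z + w , sum-mem p q
    ; _*_     = λ (z , p) (w , q) → z * w , prod-mem p q
    ; -_      = λ (z , p) → - z , neg-mem p
    ; 0#      = 0ℂ , rational 0ℚ
    ; 1#      = 1ℂ , rational 1ℚ
    }

  -- Gal(ℚ⟮ S ⟯ / ℚ)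
  record Gal : Set where
    open RingMorphisms ℚ⟮⟯-rawRing ℚ⟮⟯-rawRing using (IsRingIsomorphism)
    field
      fun               : Σ ℂ ℚ⟮ S ⟯ → Σ ℂ ℚ⟮ S ⟯
      isRingIsomorphism : IsRingIsomorphism fun
      fixes-ℚ           : ∀ q → proj₁ (fun (⟨ q ⟩ , rational q)) ≈ ⟨ q ⟩

-- Commutative d-class association schemes on X = Fin size.  The partition
-- R₀, …, R_d of X × X is given by the map sending each pair to the index of
-- its class; surjectivity says that the classes are nonempty.
record AssociationScheme (d : ℕ) : Set where
  field
    size          : ℕ
    nonEmpty      : ℕ.NonZero size
    rel           : Fin size → Fin size → Fin (suc d)
    rel-onto      : ∀ i → ∃₂ λ a b → rel a b ≡ i
    rel-identity  : ∀ a b → rel a b ≡ zero ⇔ a ≡ b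
    rel-transpose : ∀ i → ∃ λ i′ → ∀ a b → rel b a ≡ i ⇔ rel a b ≡ i′
    p             : Fin (suc d) → Fin (suc d) → Fin (suc d) → ℕ
    p-comm        : ∀ i j k → p i j k ≡ p j i k
    p-count       : ∀ i j k a b → rel a b ≡ k →
                    length (filter (λ c → (rel a c ≟ i) ×-dec (rel c b ≟ j)) (allFin size))
                      ≡ p i j k

  A : Fin (suc d) → Fin size → Fin size → ℚ
  A i a b = if does (rel a b ≟ i) then 1ℚ else 0ℚ

  Aℂ : Fin (suc d) → Matrix size size
  Aℂ i = ⟨ A i ⟩ᴹ

  1/∣X∣ : ℚ
  1/∣X∣ = (1ℤ / size) {{nonEmpty}}

  𝔽-generators : Pred ℂ 0ℓ
  𝔽-generators θ = ∃ λ (i : Fin d) → θ ∈ Eigenvalue (Aℂ (suc i))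

  𝔽 : Pred ℂ 0ℓ
  𝔽 = ℚ⟮ 𝔽-generators ⟯

dot : ∀ {n} → Vector ℚ n → Vector ℚ n → ℚ
dot x y = ∑ℚ λ a → x a ℚ.* y a

NonZeroVector : ∀ {n} → Vector ℚ n → Set
NonZeroVector x = ¬ (∀ a → x a ≡ 0ℚ)

private
  0≤sq : ∀ q → 0ℚ ℚ.≤ q ℚ.* q
  0≤sq q with ℚ.≤-total 0ℚ q
  ... | inj₁ 0≤q =
    ℚ.nonNegative⁻¹ _ {{ℚ.nonNeg*nonNeg⇒nonNeg q {{ℚ.nonNegative 0≤q}} q {{ℚ.nonNegative 0≤q}}}}
  ... | inj₂ q≤0 =
    ℚ.nonNegative⁻¹ _ {{ℚ.nonPos*nonPos⇒nonPos q {{ℚ.nonPositive q≤0}} q {{ℚ.nonPositive q≤0}}}}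

  0≤dot : ∀ {n} (x : Vector ℚ n) → 0ℚ ℚ.≤ dot x x
  0≤dot {ℕ.zero} x = ℚ.≤-refl
  0≤dot {suc n}  x = ℚ.+-mono-≤ (0≤sq (x zero)) (0≤dot (λ a → x (suc a)))

  +-zeroˡ : ∀ {p q} → 0ℚ ℚ.≤ p → 0ℚ ℚ.≤ q → p ℚ.+ q ≡ 0ℚ → p ≡ 0ℚ
  +-zeroˡ {p} {q} 0≤p 0≤q eq = ℚ.≤-antisym (begin
    p          ≡⟨ ℚ.+-identityʳ p ⟨
    p ℚ.+ 0ℚ   ≤⟨ ℚ.+-monoʳ-≤ p 0≤q ⟩
    p ℚ.+ q    ≡⟨ eq ⟩
    0ℚ         ∎) 0≤p
    where open ℚ.≤-Reasoning

  sq≡0 : ∀ q → q ℚ.* q ≡ 0ℚ → q ≡ 0ℚ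
  sq≡0 q eq with q ℚ.≟ 0ℚ
  ... | yes q≡0 = q≡0
  ... | no  q≢0 = trans (sym (ℚ.*-identityˡ q))
    (trans (cong (ℚ._* q) (sym (ℚ.*-inverseˡ q)))
    (trans (ℚ.*-assoc (ℚ.1/ q) q q)
    (trans (cong (ℚ.1/ q ℚ.*_) eq) (ℚ.*-zeroʳ (ℚ.1/ q)))))
    where instance _ = ℚ.≢-nonZero q≢0

  dot≡0 : ∀ {n} (x : Vector ℚ n) → dot x x ≡ 0ℚ → ∀ a → x a ≡ 0ℚ
  dot≡0 x eq zero    = sq≡0 (x zero) (+-zeroˡ (0≤sq (x zero)) (0≤dot (λ a → x (suc a))) eq)
  dot≡0 x eq (suc a) = dot≡0 (λ a → x (suc a))
    (+-zeroˡ (0≤dot (λ a → x (suc a))) (0≤sq (x zero))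
      (trans (ℚ.+-comm (dot (λ a → x (suc a)) (λ a → x (suc a))) (x zero ℚ.* x zero)) eq)) a

dot-nonZero : ∀ {n} (x : Vector ℚ n) → NonZeroVector x → ℚ.NonZero (dot x x)
dot-nonZero x x≢0 = ℚ.≢-nonZero λ eq → x≢0 (dot≡0 x eq)

module _ {d : ℕ} (𝔛 : AssociationScheme d) where
  open AssociationScheme 𝔛

  innerDistribution : (x : Vector ℚ size) → NonZeroVector x → Vector ℚ (suc d)
  innerDistribution x x≢0 i =
    (dot x (λ a → dot (A i a) x) ÷ dot x x) {{dot-nonZero x x≢0}}

  -- E₀, …, E_d is the basis of primitive idempotents of the complex span of
  -- A₀, …, A_d.  Primitivity of each E j follows: a basis of pairwise
  -- orthogonal idempotents identifies the span with ℂ^(d+1).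
  record IsPrimitiveIdempotentBasis (E : Fin (suc d) → Matrix size size) : Set where
    field
      in-span      : ∀ j → E j ∈ Span Aℂ
      spanning     : ∀ M → M ∈ Span Aℂ → M ∈ Span E
      independent  : LinearlyIndependent E
      idempotent   : ∀ j → E j *ᴹ E j ≈ᴹ E j
      orthogonal   : ∀ i j → i ≢ j → E i *ᴹ E j ≈ᴹ 0ᴹ
      sum-identity : ∑ᴹ E ≈ᴹ Iᴹ
      E₀           : ∀ a b → E zero a b ≈ ⟨ 1/∣X∣ ⟩

  IsSecondEigenmatrix : (E : Fin (suc d) → Matrix size size) → Matrix (suc d) (suc d) → Set
  IsSecondEigenmatrix E Q = ∀ j → E j ≈ᴹ ⟨ 1/∣X∣ ⟩ •ᴹ ∑ᴹ (λ i → Q i j •ᴹ Aℂ i)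

  -- σ ∈ Σℚ E when some 𝛔 ∈ Gal(𝔽/ℚ), applied entrywise, maps E j to
  -- E (σ j) for every j.
  Σℚ : (E : Fin (suc d) → Matrix size size) → Pred (Permutation′ (suc d)) 0ℓ
  Σℚ E σ = ∃ λ (𝛔 : Gal 𝔽-generators) → ∀ j a b →
    ∃ λ (m : E j a b ∈ 𝔽) → proj₁ (Gal.fun 𝛔 (E j a b , m)) ≈ E (σ ⟨$⟩ʳ j) a b

  -- The fibres of ι are the orbits 𝒬₀, …, 𝒬ₑ of Σℚ, numbered so that 𝒬₀ is
  -- the orbit of 0, which is {0} because E₀ has rational entries.
  record IsOrbitIndex (E : Fin (suc d) → Matrix size size)
                      {e : ℕ} (ι : Fin (suc d) → Fin (suc e)) : Set where
    field
      onto   : Surjective _≡_ _≡_ ι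
      orbits : ∀ i j → ι i ≡ ι j ⇔ (∃ λ σ → σ ∈ Σℚ E × σ ⟨$⟩ʳ i ≡ j)
      ι₀     : ∀ i → ι i ≡ zero ⇔ i ≡ zero

  DesignIndices : (E : Fin (suc d) → Matrix size size) → Vector ℚ size → Pred (Fin (suc d)) 0ℓ
  DesignIndices E x j = E j *ᵛ ⟨ x ⟩ᵛ ≈ᵛ 0ᵛ

orbit : ∀ {d e} → (Fin (suc d) → Fin (suc e)) → Fin (suc e) → Pred (Fin (suc d)) 0ℓ
orbit ι ℓ i = ι i ≡ ℓ

orbitMatrix : ∀ {d e} → (Fin (suc d) → Fin (suc e)) → Matrix (suc d) (suc e)
orbitMatrix ι i ℓ = if does (ι i ≟ ℓ) then 1ℂ else 0ℂ

orbitIdempotent : ∀ {d e n} → (Fin (suc d) → Matrix n n) → (Fin (suc d) → Fin (suc e)) →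
                  Fin (suc e) → Matrix n n
orbitIdempotent E ι ℓ = ∑ᴹ λ i → if does (ι i ≟ ℓ) then E i else 0ᴹ

{-# OPTIONS --safe #-}
-- A Galois automorphism 𝛔 fixes the rational vector x, so applying 𝛔 to
-- E_j x = 0 gives E_{σ j} x = 0; hence T(C) is a union of orbits.  The link
-- with the inner distribution is aQ_i = (|X| / xᵀx) · xᵀE_i x, and E_i is an
-- orthogonal projection, so xᵀE_i x = ‖E_i x‖² vanishes exactly when E_i x
-- does.  The scheme enters only through closure of the span of the A_i under
-- conjugate transposition, which makes E_i Hermitian.
module Submission where

open import Defs
open import Level using (0ℓ)
open import Algebra.Bundles using (CommutativeRing)
open import Algebra.Morphism.Structures using (module RingMorphisms)
import Algebra.Properties.Ring
import Algebra.Properties.Semiring.Sum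
open import Data.Bool.Base using (true; false; if_then_else_)
open import Data.Fin.Base using (Fin; zero; suc)
open import Data.Fin.Permutation using (_⟨$⟩ʳ_)
open import Data.Fin.Properties using (_≟_; suc-injective)
open import Data.Nat.Base as ℕ using (ℕ; suc; _≥_)
import Data.Nat.Properties as ℕ
open import Data.Product.Base using (∃; ∃₂; _×_; _,_; proj₁; proj₂)
open import Data.Rational.Base as ℚ using (ℚ; 0ℚ; 1ℚ; ½; ∣_∣)
import Data.Rational.Properties as ℚ
open import Data.Rational.Solver using (module +-*-Solver)
open import Data.Sum.Base using (inj₁; inj₂)
open import Data.Vec.Functional using (Vector)
open import Function.Base using (_∘_)
open import Function.Bundles using (_⇔_; mk⇔; module Equivalence)
open import Relation.Binary.PropositionalEquality as ≡ using (_≡_; _≢_; cong; subst)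
import Relation.Binary.Reasoning.Setoid
open import Relation.Nullary using (yes; no; contradiction; does)
open import Relation.Nullary.Decidable using (dec-true; dec-false)
open import Relation.Unary using (Pred; _∈_; _∉_)

open Real using (ℝ; seq; cauchy; null)

-- Null sequences of rationals

Null : (ℕ → ℚ) → Set
Null f = ∀ ε → 0ℚ ℚ.< ε → ∃ λ N → ∀ n → n ≥ N → ∣ f n ∣ ℚ.< ε

-- What one factor must satisfy for its product with a null sequence to be null; every Cauchy
-- sequence does.
EventuallyBounded : (ℕ → ℚ) → Set
EventuallyBounded f = ∃₂ λ N B → 0ℚ ℚ.< B × (∀ n → n ≥ N → ∣ f n ∣ ℚ.≤ B)

Null-dominated : ∀ {f g} → (∀ n → ∣ g n ∣ ℚ.≤ ∣ f n ∣) → Null f → Null g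
Null-dominated g≤f fnull ε ε>0 =
  let (N , small) = fnull ε ε>0
  in N , λ n n≥N → ℚ.≤-<-trans (g≤f n) (small n n≥N)

Null-resp-≗ : ∀ {f g} → (∀ n → f n ≡ g n) → Null f → Null g
Null-resp-≗ f≗g = Null-dominated λ n → ℚ.≤-reflexive (cong ∣_∣ (≡.sym (f≗g n)))

Null-zero : ∀ {f} → (∀ n → f n ≡ 0ℚ) → Null f
Null-zero f≗0 ε ε>0 = 0 , λ n _ → subst (ℚ._< ε) (≡.sym (cong ∣_∣ (f≗0 n))) ε>0

Null-neg : ∀ {f} → Null f → Null (λ n → ℚ.- f n)
Null-neg {f} = Null-dominated λ n → ℚ.≤-reflexive (ℚ.∣-p∣≡∣p∣ (f n))

Null-+ : ∀ {f g} → Null f → Null g → Null (λ n → f n ℚ.+ g n)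
Null-+ {f} {g} fnull gnull ε ε>0 =
  let (N , f<) = fnull (½ ℚ.* ε) half>0
      (M , g<) = gnull (½ ℚ.* ε) half>0
  in N ℕ.⊔ M , λ n n≥ → begin-strict
    ∣ f n ℚ.+ g n ∣          ≤⟨ ℚ.∣p+q∣≤∣p∣+∣q∣ (f n) (g n) ⟩
    ∣ f n ∣ ℚ.+ ∣ g n ∣      <⟨ ℚ.+-mono-< (f< n (ℕ.m⊔n≤o⇒m≤o N M n≥)) (g< n (ℕ.m⊔n≤o⇒n≤o N M n≥)) ⟩
    ½ ℚ.* ε ℚ.+ ½ ℚ.* ε      ≡⟨ ℚ.*-distribʳ-+ ε ½ ½ ⟨
    1ℚ ℚ.* ε                 ≡⟨ ℚ.*-identityˡ ε ⟩
    ε                        ∎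
  where
  open ℚ.≤-Reasoning
  half>0 = ℚ.positive⁻¹ (½ ℚ.* ε) {{ℚ.pos*pos⇒pos ½ ε {{ℚ.positive ε>0}}}}

Null-* : ∀ {f g} → EventuallyBounded f → Null g → Null (λ n → f n ℚ.* g n)
Null-* {f} {g} (N , B , B>0 , f≤B) gnull ε ε>0 =
  let (M , g<) = gnull δ (ℚ.positive⁻¹ δ)
  in N ℕ.⊔ M , λ n n≥ → begin-strict
    ∣ f n ℚ.* g n ∣        ≡⟨ ℚ.∣p*q∣≡∣p∣*∣q∣ (f n) (g n) ⟩
    ∣ f n ∣ ℚ.* ∣ g n ∣    ≤⟨ ℚ.*-monoʳ-≤-nonNeg ∣ g n ∣ {{ℚ.∣-∣-nonNeg (g n)}} (f≤B n (ℕ.m⊔n≤o⇒m≤o N M n≥)) ⟩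
    B ℚ.* ∣ g n ∣          <⟨ ℚ.*-monoʳ-<-pos B (g< n (ℕ.m⊔n≤o⇒n≤o N M n≥)) ⟩
    B ℚ.* (ℚ.1/ B ℚ.* ε)   ≡⟨ ℚ.*-assoc B (ℚ.1/ B) ε ⟨
    B ℚ.* ℚ.1/ B ℚ.* ε     ≡⟨ cong (ℚ._* ε) (ℚ.*-inverseʳ B) ⟩
    1ℚ ℚ.* ε               ≡⟨ ℚ.*-identityˡ ε ⟩
    ε                      ∎
  where
  open ℚ.≤-Reasoning
  instance
    _ = ℚ.positive B>0
    _ = ℚ.positive ε>0
    _ = ℚ.pos⇒nonZero B
    _ = ℚ.1/pos⇒pos B
  -- The tolerance for `g` is ε divided by the bound on `f`, so the estimate ends in `B * δ = ε`.
  δ = ℚ.1/ B ℚ.* ε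
  instance
    _ = ℚ.pos*pos⇒pos (ℚ.1/ B) ε

private
  ∣p∣≤∣p+q∣ : ∀ {p q} → 0ℚ ℚ.≤ p → 0ℚ ℚ.≤ q → ∣ p ∣ ℚ.≤ ∣ p ℚ.+ q ∣
  ∣p∣≤∣p+q∣ {p} {q} p≥0 q≥0 = begin
    ∣ p ∣        ≡⟨ ℚ.0≤p⇒∣p∣≡p p≥0 ⟩
    p            ≡⟨ ℚ.+-identityʳ p ⟨
    p ℚ.+ 0ℚ     ≤⟨ ℚ.+-monoʳ-≤ p q≥0 ⟩
    p ℚ.+ q      ≡⟨ ℚ.0≤p⇒∣p∣≡p (ℚ.+-mono-≤ p≥0 q≥0) ⟨
    ∣ p ℚ.+ q ∣  ∎
    where open ℚ.≤-Reasoning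

-- Termwise nonnegativity gives `∣ f n ∣ ≤ ∣ f n + g n ∣`. This is the source of every later
-- argument that a vanishing sum of nonnegative terms has vanishing terms.
Null-sumˡ : ∀ (f g : ℕ → ℚ) → (∀ n → 0ℚ ℚ.≤ f n) → (∀ n → 0ℚ ℚ.≤ g n) →
            Null (λ n → f n ℚ.+ g n) → Null f
Null-sumˡ f g f≥0 g≥0 = Null-dominated λ n → ∣p∣≤∣p+q∣ {f n} {g n} (f≥0 n) (g≥0 n)

-- Use tolerance ε² for the squares: `∣ f n ∣ ≥ ε` would force `∣ f n * f n ∣ ≥ ε * ε`.
Null-square : ∀ {f} → Null (λ n → f n ℚ.* f n) → Null f
Null-square {f} f²null ε ε>0 =
  let (N , f²<) = f²null (ε ℚ.* ε) ε²>0
  in N , λ n n≥ → ℚ.≰⇒> λ ε≤f → ℚ.<-irrefl ≡.refl (ℚ.<-≤-trans (f²< n n≥) (begin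
    ε ℚ.* ε                ≤⟨ ℚ.*-monoˡ-≤-nonNeg ε ε≤f ⟩
    ε ℚ.* ∣ f n ∣          ≤⟨ ℚ.*-monoʳ-≤-nonNeg ∣ f n ∣ {{ℚ.∣-∣-nonNeg (f n)}} ε≤f ⟩
    ∣ f n ∣ ℚ.* ∣ f n ∣    ≡⟨ ℚ.∣p*q∣≡∣p∣*∣q∣ (f n) (f n) ⟨
    ∣ f n ℚ.* f n ∣        ∎))
  where
  open ℚ.≤-Reasoning
  instance
    _ = ℚ.positive ε>0
    _ = ℚ.pos⇒nonNeg ε
  ε²>0 = ℚ.positive⁻¹ (ε ℚ.* ε) {{ℚ.pos*pos⇒pos ε ε}}

-- If `q` were nonzero, the tolerance `∣ q ∣` would give `∣ q ∣ < ∣ q ∣`. This brings equations in ℂ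
-- between rationals back to ℚ.
Null-constant : ∀ {q} → Null (λ _ → q) → q ≡ 0ℚ
Null-constant {q} qnull with q ℚ.≟ 0ℚ
... | yes q≡0 = q≡0
... | no  q≢0 =
  let (N , q<q) = qnull ∣ q ∣ (ℚ.positive⁻¹ ∣ q ∣ {{ℚ.nonNeg∧nonZero⇒pos ∣ q ∣}})
  in contradiction (q<q N ℕ.≤-refl) (ℚ.<-irrefl ≡.refl)
  where instance
    _ = ℚ.∣-∣-nonNeg q
    _ = ℚ.≢-nonZero λ ∣q∣≡0 → q≢0 (ℚ.∣p∣≡0⇒p≡0 q ∣q∣≡0)

-- ℂ as a commutative ring

module Reals where

  ≗⇒≈ : ∀ {x y} → (∀ n → seq x n ≡ seq y n) → x Real.≈ y
  ≗⇒≈ {x} {y} x≗y = Real.mk≈ (Null-zero λ n →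
    ≡.trans (cong (ℚ._- seq y n) (x≗y n)) (ℚ.+-inverseʳ (seq y n)))

  -- From the index `N` belonging to tolerance 1 onwards, each term is within 1 of term `N`.
  eventuallyBounded : ∀ x → EventuallyBounded (seq x)
  eventuallyBounded x =
    let (N , close) = cauchy x 1ℚ (ℚ.positive⁻¹ 1ℚ)
    in N , 1ℚ ℚ.+ ∣ seq x N ∣ , ℚ.+-mono-<-≤ (ℚ.positive⁻¹ 1ℚ) (ℚ.0≤∣p∣ (seq x N)) , λ n n≥N → begin
      ∣ seq x n ∣                               ≡⟨ cong ∣_∣ (split (seq x n) (seq x N)) ⟩
      ∣ (seq x n ℚ.- seq x N) ℚ.+ seq x N ∣     ≤⟨ ℚ.∣p+q∣≤∣p∣+∣q∣ (seq x n ℚ.- seq x N) (seq x N) ⟩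
      ∣ seq x n ℚ.- seq x N ∣ ℚ.+ ∣ seq x N ∣   ≤⟨ ℚ.+-monoˡ-≤ ∣ seq x N ∣ (ℚ.<⇒≤ (close n N n≥N ℕ.≤-refl)) ⟩
      1ℚ ℚ.+ ∣ seq x N ∣                        ∎
    where
    open ℚ.≤-Reasoning
    split : ∀ a b → a ≡ (a ℚ.- b) ℚ.+ b
    split = solve 2 (λ a b → a := (a :- b) :+ b) ≡.refl
      where open +-*-Solver

  ≈-sym : ∀ {x y} → x Real.≈ y → y Real.≈ x
  ≈-sym {x} {y} x≈y = Real.mk≈ (Null-resp-≗
    (λ n → solve 2 (λ a b → :- (a :- b) := b :- a) ≡.refl (seq x n) (seq y n))
    (Null-neg (null x≈y)))
    where open +-*-Solver

  ≈-trans : ∀ {x y z} → x Real.≈ y → y Real.≈ z → x Real.≈ z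
  ≈-trans {x} {y} {z} x≈y y≈z = Real.mk≈ (Null-resp-≗
    (λ n → solve 3 (λ a b c → (a :- b) :+ (b :- c) := a :- c) ≡.refl (seq x n) (seq y n) (seq z n))
    (Null-+ (null x≈y) (null y≈z)))
    where open +-*-Solver

  +-cong : ∀ {x y u v} → x Real.≈ y → u Real.≈ v → x Real.+ u Real.≈ y Real.+ v
  +-cong {x} {y} {u} {v} x≈y u≈v = Real.mk≈ (Null-resp-≗
    (λ n → solve 4 (λ a b c d → (a :- b) :+ (c :- d) := (a :+ c) :- (b :+ d)) ≡.refl
      (seq x n) (seq y n) (seq u n) (seq v n))
    (Null-+ (null x≈y) (null u≈v)))
    where open +-*-Solver

  -- The difference xu - yv splits as u(x - y) + y(u - v), each summand being a bounded sequence
  -- times a null one.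
  *-cong : ∀ {x y u v} → x Real.≈ y → u Real.≈ v → x Real.* u Real.≈ y Real.* v
  *-cong {x} {y} {u} {v} x≈y u≈v = Real.mk≈ (Null-resp-≗
    (λ n → solve 4 (λ a b c d → c :* (a :- b) :+ b :* (c :- d) := (a :* c) :- (b :* d)) ≡.refl
      (seq x n) (seq y n) (seq u n) (seq v n))
    (Null-+ (Null-* (eventuallyBounded u) (null x≈y)) (Null-* (eventuallyBounded y) (null u≈v))))
    where open +-*-Solver

  -‿cong : ∀ {x y} → x Real.≈ y → Real.- x Real.≈ Real.- y
  -‿cong {x} {y} x≈y = Real.mk≈ (Null-resp-≗
    (λ n → solve 2 (λ a b → :- (a :- b) := :- a :- :- b) ≡.refl (seq x n) (seq y n))
    (Null-neg (null x≈y)))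
    where open +-*-Solver

-- The operations act termwise on the sequences, so a ring identity in ℂ reduces to polynomial
-- identities over ℚ at each index.
≗⇒≈ : ∀ {z w} → (∀ n → seq (re z) n ≡ seq (re w) n) → (∀ n → seq (im z) n ≡ seq (im w) n) → z ≈ w
≗⇒≈ p q = mk≈ (Reals.≗⇒≈ p) (Reals.≗⇒≈ q)

private
  ℂ-+-assoc : ∀ x y z → x + y + z ≈ x + (y + z)
  ℂ-+-assoc x y z = ≗⇒≈
    (λ n → ℚ.+-assoc (seq (re x) n) (seq (re y) n) (seq (re z) n))
    (λ n → ℚ.+-assoc (seq (im x) n) (seq (im y) n) (seq (im z) n))

  ℂ-+-comm : ∀ x y → x + y ≈ y + x
  ℂ-+-comm x y = ≗⇒≈
    (λ n → ℚ.+-comm (seq (re x) n) (seq (re y) n))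
    (λ n → ℚ.+-comm (seq (im x) n) (seq (im y) n))

  ℂ-+-identityˡ : ∀ x → 0ℂ + x ≈ x
  ℂ-+-identityˡ x = ≗⇒≈ (λ n → ℚ.+-identityˡ (seq (re x) n)) (λ n → ℚ.+-identityˡ (seq (im x) n))

  ℂ-+-identityʳ : ∀ x → x + 0ℂ ≈ x
  ℂ-+-identityʳ x = ≗⇒≈ (λ n → ℚ.+-identityʳ (seq (re x) n)) (λ n → ℚ.+-identityʳ (seq (im x) n))

  ℂ--‿inverseˡ : ∀ x → - x + x ≈ 0ℂ
  ℂ--‿inverseˡ x = ≗⇒≈ (λ n → ℚ.+-inverseˡ (seq (re x) n)) (λ n → ℚ.+-inverseˡ (seq (im x) n))

  ℂ--‿inverseʳ : ∀ x → x + - x ≈ 0ℂ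
  ℂ--‿inverseʳ x = ≗⇒≈ (λ n → ℚ.+-inverseʳ (seq (re x) n)) (λ n → ℚ.+-inverseʳ (seq (im x) n))

  ℂ-*-cong : ∀ {x y u v} → x ≈ y → u ≈ v → x * u ≈ y * v
  ℂ-*-cong (mk≈ p q) (mk≈ r s) = mk≈
    (Reals.+-cong (Reals.*-cong p r) (Reals.-‿cong (Reals.*-cong q s)))
    (Reals.+-cong (Reals.*-cong p s) (Reals.*-cong q r))

  ℂ-*-assoc : ∀ x y z → x * y * z ≈ x * (y * z)
  ℂ-*-assoc x y z = ≗⇒≈
    (λ n → solve 6 (λ a b c d e f →
        (a :* c :+ :- (b :* d)) :* e :+ :- ((a :* d :+ b :* c) :* f)
        := a :* (c :* e :+ :- (d :* f)) :+ :- (b :* (c :* f :+ d :* e))) ≡.refl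
      (seq (re x) n) (seq (im x) n) (seq (re y) n) (seq (im y) n) (seq (re z) n) (seq (im z) n))
    (λ n → solve 6 (λ a b c d e f →
        (a :* c :+ :- (b :* d)) :* f :+ (a :* d :+ b :* c) :* e
        := a :* (c :* f :+ d :* e) :+ b :* (c :* e :+ :- (d :* f))) ≡.refl
      (seq (re x) n) (seq (im x) n) (seq (re y) n) (seq (im y) n) (seq (re z) n) (seq (im z) n))
    where open +-*-Solver

  ℂ-*-comm : ∀ x y → x * y ≈ y * x
  ℂ-*-comm x y = ≗⇒≈
    (λ n → solve 4 (λ a b c d → a :* c :+ :- (b :* d) := c :* a :+ :- (d :* b)) ≡.refl
      (seq (re x) n) (seq (im x) n) (seq (re y) n) (seq (im y) n))
    (λ n → solve 4 (λ a b c d → a :* d :+ b :* c := c :* b :+ d :* a) ≡.refl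
      (seq (re x) n) (seq (im x) n) (seq (re y) n) (seq (im y) n))
    where open +-*-Solver

  ℂ-*-identityˡ : ∀ x → 1ℂ * x ≈ x
  ℂ-*-identityˡ x = ≗⇒≈
    (λ n → solve 2 (λ a b → con 1ℚ :* a :+ :- (con 0ℚ :* b) := a) ≡.refl (seq (re x) n) (seq (im x) n))
    (λ n → solve 2 (λ a b → con 1ℚ :* b :+ con 0ℚ :* a := b) ≡.refl (seq (re x) n) (seq (im x) n))
    where open +-*-Solver

  ℂ-distribˡ : ∀ x y z → x * (y + z) ≈ x * y + x * z
  ℂ-distribˡ x y z = ≗⇒≈
    (λ n → solve 6 (λ a b c d e f →
        a :* (c :+ e) :+ :- (b :* (d :+ f)) := (a :* c :+ :- (b :* d)) :+ (a :* e :+ :- (b :* f))) ≡.refl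
      (seq (re x) n) (seq (im x) n) (seq (re y) n) (seq (im y) n) (seq (re z) n) (seq (im z) n))
    (λ n → solve 6 (λ a b c d e f →
        a :* (d :+ f) :+ b :* (c :+ e) := (a :* d :+ b :* c) :+ (a :* f :+ b :* e)) ≡.refl
      (seq (re x) n) (seq (im x) n) (seq (re y) n) (seq (im y) n) (seq (re z) n) (seq (im z) n))
    where open +-*-Solver

  ℂ-+-cong : ∀ {x y u v} → x ≈ y → u ≈ v → x + u ≈ y + v
  ℂ-+-cong (mk≈ p q) (mk≈ r s) = mk≈ (Reals.+-cong p r) (Reals.+-cong q s)

  ℂ-trans : ∀ {x y z} → x ≈ y → y ≈ z → x ≈ z
  ℂ-trans (mk≈ p q) (mk≈ r s) = mk≈ (Reals.≈-trans p r) (Reals.≈-trans q s)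

ℂ-commutativeRing : CommutativeRing 0ℓ 0ℓ
ℂ-commutativeRing = record
  { Carrier = ℂ ; _≈_ = _≈_ ; _+_ = _+_ ; _*_ = _*_ ; -_ = -_ ; 0# = 0ℂ ; 1# = 1ℂ
  ; isCommutativeRing = record
    { isRing = record
      { +-isAbelianGroup = record
        { isGroup = record
          { isMonoid = record
            { isSemigroup = record
              { isMagma = record
                { isEquivalence = record
                  { refl  = ≗⇒≈ (λ _ → ≡.refl) (λ _ → ≡.refl)
                  ; sym   = λ (mk≈ p q) → mk≈ (Reals.≈-sym p) (Reals.≈-sym q)
                  ; trans = ℂ-trans
                  }
                ; ∙-cong = ℂ-+-cong
                }
              ; assoc = ℂ-+-assoc
              }
            ; identity = ℂ-+-identityˡ , ℂ-+-identityʳ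
            }
          ; inverse = ℂ--‿inverseˡ , ℂ--‿inverseʳ
          ; ⁻¹-cong = λ (mk≈ p q) → mk≈ (Reals.-‿cong p) (Reals.-‿cong q)
          }
        ; comm = ℂ-+-comm
        }
      ; *-cong = ℂ-*-cong
      ; *-assoc = ℂ-*-assoc
      ; *-identity = ℂ-*-identityˡ , λ x → ℂ-trans (ℂ-*-comm x 1ℂ) (ℂ-*-identityˡ x)
      ; distrib = ℂ-distribˡ , λ x y z → ℂ-trans (ℂ-*-comm (y + z) x)
          (ℂ-trans (ℂ-distribˡ x y z) (ℂ-+-cong (ℂ-*-comm x y) (ℂ-*-comm x z)))
      }
    ; *-comm = ℂ-*-comm
    }
  }

open CommutativeRing ℂ-commutativeRing using
  ( setoid; refl; sym; trans; reflexive; +-cong; +-congˡ; +-identityˡ; +-identityʳ; +-assoc; +-comm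
  ; -‿cong; -‿inverseˡ; -‿inverseʳ
  ; *-cong; *-congˡ; *-congʳ; *-assoc; *-comm; *-identityˡ; *-identityʳ; distribʳ; zeroˡ; zeroʳ
  ; ring; semiring )
open Algebra.Properties.Ring ring using (-‿distribˡ-*)
open Algebra.Properties.Semiring.Sum semiring using
  (sum-cong-≋; sum-replicate-zero; ∑-distrib-+; ∑-comm; *-distribˡ-sum; *-distribʳ-sum)

module ≈-Reasoning = Relation.Binary.Reasoning.Setoid setoid

-- Finite sums

∑-zero : ∀ {n} (v : Vector ℂ n) → v ≈ᵛ 0ᵛ → ∑ v ≈ 0ℂ
∑-zero {n} v v≈0 = trans (sum-cong-≋ v≈0) (sum-replicate-zero n)

∑-single : ∀ {n} (v : Vector ℂ n) i → (∀ k → k ≢ i → v k ≈ 0ℂ) → ∑ v ≈ v i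
∑-single v zero    v≈0 =
  trans (+-congˡ (∑-zero (v ∘ suc) λ k → v≈0 (suc k) λ ())) (+-identityʳ (v zero))
∑-single v (suc i) v≈0 =
  trans (+-cong (v≈0 zero λ ()) (∑-single (v ∘ suc) i λ k k≢i → v≈0 (suc k) (k≢i ∘ suc-injective)))
        (+-identityˡ (v (suc i)))

-- Exchange of the two sums. With `u` a row and `v` a column of further matrices, this is also
-- associativity of the matrix product, entry by entry.
∑-assoc : ∀ {m n} (u : Vector ℂ m) (M : Matrix m n) (v : Vector ℂ n) →
          ∑ (λ a → u a * (M *ᵛ v) a) ≈ ∑ (λ b → (u ᵛ* M) b * v b)
∑-assoc u M v = begin
  ∑ (λ a → u a * ∑ (λ b → M a b * v b))      ≈⟨ sum-cong-≋ (λ a → *-distribˡ-sum (u a) (λ b → M a b * v b)) ⟩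
  ∑ (λ a → ∑ (λ b → u a * (M a b * v b)))    ≈⟨ ∑-comm (λ a b → u a * (M a b * v b)) ⟩
  ∑ (λ b → ∑ (λ a → u a * (M a b * v b)))    ≈⟨ sum-cong-≋ (λ b → sum-cong-≋ λ a → sym (*-assoc (u a) (M a b) (v b))) ⟩
  ∑ (λ b → ∑ (λ a → u a * M a b * v b))      ≈⟨ sum-cong-≋ (λ b → sym (*-distribʳ-sum (v b) (λ a → u a * M a b))) ⟩
  ∑ (λ b → ∑ (λ a → u a * M a b) * v b)      ∎
  where open ≈-Reasoning

*-left-comm : ∀ x y z → x * (y * z) ≈ y * (x * z)
*-left-comm x y z = trans (sym (*-assoc x y z)) (trans (*-congʳ (*-comm x y)) (*-assoc y x z))

∑ᴹ-*ᵛ : ∀ {k m n} (B : Fin k → Matrix m n) v a → (∑ᴹ B *ᵛ v) a ≈ ∑ (λ i → (B i *ᵛ v) a)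
∑ᴹ-*ᵛ B v a = trans
  (sum-cong-≋ λ b → *-distribʳ-sum (v b) (λ i → B i a b))
  (∑-comm λ b i → B i a b * v b)

•ᴹ-*ᵛ : ∀ {m n} c (M : Matrix m n) v a → ((c •ᴹ M) *ᵛ v) a ≈ c * (M *ᵛ v) a
•ᴹ-*ᵛ c M v a = trans
  (sum-cong-≋ λ b → *-assoc c (M a b) (v b))
  (sym (*-distribˡ-sum c λ b → M a b * v b))

-- Rational numbers inside ℂ

⟨⟩-+ : ∀ p q → ⟨ p ℚ.+ q ⟩ ≈ ⟨ p ⟩ + ⟨ q ⟩
⟨⟩-+ p q = ≗⇒≈ (λ _ → ≡.refl) (λ _ → ≡.refl)

⟨⟩-* : ∀ p q → ⟨ p ℚ.* q ⟩ ≈ ⟨ p ⟩ * ⟨ q ⟩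
⟨⟩-* p q = ≗⇒≈
  (λ _ → ≡.sym (ℚ.+-identityʳ (p ℚ.* q)))
  (λ _ → solve 2 (λ a b → con 0ℚ := a :* con 0ℚ :+ con 0ℚ :* b) ≡.refl p q)
  where open +-*-Solver

⟨⟩-∑ : ∀ {n} (v : Vector ℚ n) → ⟨ ∑ℚ v ⟩ ≈ ∑ ⟨ v ⟩ᵛ
⟨⟩-∑ {ℕ.zero} v = refl
⟨⟩-∑ {suc n}  v = trans (⟨⟩-+ (v zero) (∑ℚ (v ∘ suc))) (+-congˡ (⟨⟩-∑ (v ∘ suc)))

⟨⟩-dot : ∀ {n} (x y : Vector ℚ n) → ⟨ dot x y ⟩ ≈ ∑ (λ a → ⟨ x a ⟩ * ⟨ y a ⟩)
⟨⟩-dot x y = trans (⟨⟩-∑ (λ a → x a ℚ.* y a)) (sum-cong-≋ λ a → ⟨⟩-* (x a) (y a))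

⟨⟩≈0⇒≡0 : ∀ {q} → ⟨ q ⟩ ≈ 0ℂ → q ≡ 0ℚ
⟨⟩≈0⇒≡0 {q} q≈0 = Null-constant (Null-resp-≗ (λ _ → ℚ.+-identityʳ q) (null (re-≈ q≈0)))

-- Serves to cancel the factors `1/∣X∣` and `dot x x`; the inverse is taken in ℚ and then embedded.
⟨⟩*≈0⇒≈0 : ∀ q .{{_ : ℚ.NonZero q}} {z} → ⟨ q ⟩ * z ≈ 0ℂ → z ≈ 0ℂ
⟨⟩*≈0⇒≈0 q {z} qz≈0 = begin
  z             ≈⟨ sym (*-identityˡ z) ⟩
  1ℂ * z        ≈⟨ *-congʳ 1≈q⁻¹q ⟩
  q⁻¹ * q′ * z  ≈⟨ *-assoc q⁻¹ q′ z ⟩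
  q⁻¹ * (q′ * z) ≈⟨ *-congˡ qz≈0 ⟩
  q⁻¹ * 0ℂ      ≈⟨ zeroʳ q⁻¹ ⟩
  0ℂ            ∎
  where
  open ≈-Reasoning
  q′ = ⟨ q ⟩
  q⁻¹ = ⟨ ℚ.1/ q ⟩
  1≈q⁻¹q : 1ℂ ≈ q⁻¹ * q′
  1≈q⁻¹q = trans (reflexive (cong ⟨_⟩ (≡.sym (ℚ.*-inverseˡ q)))) (⟨⟩-* (ℚ.1/ q) q)

-- Conjugation and positivity

conj : ℂ → ℂ
conj z .re = re z
conj z .im = Real.- im z

conj-cong : ∀ {z w} → z ≈ w → conj z ≈ conj w
conj-cong (mk≈ p q) = mk≈ p (Reals.-‿cong q)

conj-involutive : ∀ z → conj (conj z) ≈ z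
conj-involutive z = ≗⇒≈ (λ _ → ≡.refl) (λ n → solve 1 (λ a → :- :- a := a) ≡.refl (seq (im z) n))
  where open +-*-Solver

conj-+ : ∀ z w → conj (z + w) ≈ conj z + conj w
conj-+ z w = ≗⇒≈ (λ _ → ≡.refl) (λ n → ℚ.neg-distrib-+ (seq (im z) n) (seq (im w) n))

conj-neg : ∀ z → conj (- z) ≈ - conj z
conj-neg z = ≗⇒≈ (λ _ → ≡.refl) (λ _ → ≡.refl)

conj-* : ∀ z w → conj (z * w) ≈ conj z * conj w
conj-* z w = ≗⇒≈
  (λ n → solve 4 (λ a b c d → a :* c :+ :- (b :* d) := a :* c :+ :- (:- b :* :- d)) ≡.refl
    (seq (re z) n) (seq (im z) n) (seq (re w) n) (seq (im w) n))
  (λ n → solve 4 (λ a b c d → :- (a :* d :+ b :* c) := a :* :- d :+ :- b :* c) ≡.refl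
    (seq (re z) n) (seq (im z) n) (seq (re w) n) (seq (im w) n))
  where open +-*-Solver

conj-⟨⟩ : ∀ q → conj ⟨ q ⟩ ≈ ⟨ q ⟩
conj-⟨⟩ q = ≗⇒≈ (λ _ → ≡.refl) (λ _ → ≡.refl)

conj-∑ : ∀ {n} (v : Vector ℂ n) → conj (∑ v) ≈ ∑ (λ i → conj (v i))
conj-∑ {ℕ.zero} v = conj-⟨⟩ 0ℚ
conj-∑ {suc n}  v = trans (conj-+ (v zero) (∑ (v ∘ suc))) (+-congˡ (conj-∑ (v ∘ suc)))

-- Nonnegativity is witnessed by a representing sequence all of whose terms are nonnegative. Such
-- witnesses add termwise, and `Null-sumˡ` applies to them directly, without an order on the reals.
record NonNegative (z : ℂ) : Set where
  field
    rep    : ℝ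
    rep≥0  : ∀ n → 0ℚ ℚ.≤ seq rep n
    re≈rep : re z Real.≈ rep
    im≈0     : im z Real.≈ Real.fromℚ 0ℚ

open NonNegative

NonNegative-resp-≈ : ∀ {z w} → z ≈ w → NonNegative z → NonNegative w
NonNegative-resp-≈ z≈w z≥0 = record
  { rep    = rep z≥0
  ; rep≥0  = rep≥0 z≥0
  ; re≈rep = Reals.≈-trans (re-≈ (sym z≈w)) (re≈rep z≥0)
  ; im≈0     = Reals.≈-trans (im-≈ (sym z≈w)) (im≈0 z≥0)
  }

NonNegative-∑ : ∀ {n} {v : Vector ℂ n} → (∀ i → NonNegative (v i)) → NonNegative (∑ v)
NonNegative-∑ {ℕ.zero} v≥0 = record
  { rep = Real.fromℚ 0ℚ ; rep≥0 = λ _ → ℚ.≤-refl ; re≈rep = re-≈ (refl {0ℂ}) ; im≈0 = im-≈ (refl {0ℂ}) }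
NonNegative-∑ {suc n} v≥0 = record
  { rep    = rep (v≥0 zero) Real.+ rep tail≥0
  ; rep≥0  = λ k → ℚ.+-mono-≤ (rep≥0 (v≥0 zero) k) (rep≥0 tail≥0 k)
  ; re≈rep = Reals.+-cong (re≈rep (v≥0 zero)) (re≈rep tail≥0)
  ; im≈0     = Reals.≈-trans (Reals.+-cong (im≈0 (v≥0 zero)) (im≈0 tail≥0)) (Reals.≗⇒≈ λ _ → ≡.refl)
  }
  where tail≥0 = NonNegative-∑ (v≥0 ∘ suc)

NonNegative-+-zeroˡ : ∀ {z w} → NonNegative z → NonNegative w → z + w ≈ 0ℂ → z ≈ 0ℂ
NonNegative-+-zeroˡ {z} {w} z≥0 w≥0 z+w≈0 = mk≈ (Reals.≈-trans (re≈rep z≥0) rep≈0) (im≈0 z≥0)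
  where
  sum≈0 : rep z≥0 Real.+ rep w≥0 Real.≈ Real.fromℚ 0ℚ
  sum≈0 = Reals.≈-trans (Reals.≈-sym (Reals.+-cong (re≈rep z≥0) (re≈rep w≥0))) (re-≈ z+w≈0)

  rep≈0 : rep z≥0 Real.≈ Real.fromℚ 0ℚ
  rep≈0 = Real.mk≈ (Null-resp-≗ (λ n → ≡.sym (ℚ.+-identityʳ _))
    (Null-sumˡ (seq (rep z≥0)) (seq (rep w≥0)) (rep≥0 z≥0) (rep≥0 w≥0) (Null-resp-≗ (λ n → ℚ.+-identityʳ _) (null sum≈0))))

∑-nonNegative-zero : ∀ {n} {v : Vector ℂ n} → (∀ i → NonNegative (v i)) → ∑ v ≈ 0ℂ → v ≈ᵛ 0ᵛ
∑-nonNegative-zero v≥0 ∑≈0 zero    =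
  NonNegative-+-zeroˡ (v≥0 zero) (NonNegative-∑ (v≥0 ∘ suc)) ∑≈0
∑-nonNegative-zero {v = v} v≥0 ∑≈0 (suc i) = ∑-nonNegative-zero (v≥0 ∘ suc)
  (NonNegative-+-zeroˡ (NonNegative-∑ (v≥0 ∘ suc)) (v≥0 zero)
    (trans (+-comm (∑ (v ∘ suc)) (v zero)) ∑≈0)) i

private
  p²≥0 : ∀ p → 0ℚ ℚ.≤ p ℚ.* p
  p²≥0 p = subst (0ℚ ℚ.≤_) eq (ℚ.nonNegative⁻¹ (∣ p ∣ ℚ.* ∣ p ∣) {{ℚ.nonNeg*nonNeg⇒nonNeg ∣ p ∣ ∣ p ∣}})
    where
    instance _ = ℚ.∣-∣-nonNeg p
    eq : ∣ p ∣ ℚ.* ∣ p ∣ ≡ p ℚ.* p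
    eq with ℚ.∣p∣≡p∨∣p∣≡-p p
    ... | inj₁ e rewrite e = ≡.refl
    ... | inj₂ e rewrite e = solve 1 (λ a → :- a :* :- a := a :* a) ≡.refl p
      where open +-*-Solver

  normSq-re : ∀ a b → a ℚ.* a ℚ.+ ℚ.- (ℚ.- b ℚ.* b) ≡ a ℚ.* a ℚ.+ b ℚ.* b
  normSq-re = solve 2 (λ a b → a :* a :+ :- (:- b :* b) := a :* a :+ b :* b) ≡.refl
    where open +-*-Solver

conj*-nonNegative : ∀ z → NonNegative (conj z * z)
conj*-nonNegative z = record
  { rep    = re z Real.* re z Real.+ im z Real.* im z
  ; rep≥0  = λ n → ℚ.+-mono-≤ (p²≥0 (seq (re z) n)) (p²≥0 (seq (im z) n))
  ; re≈rep = Reals.≗⇒≈ λ n → normSq-re (seq (re z) n) (seq (im z) n)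
  ; im≈0     = Reals.≗⇒≈ λ n →
      solve 2 (λ a b → a :* b :+ :- b :* a := con 0ℚ) ≡.refl (seq (re z) n) (seq (im z) n)
  }
  where open +-*-Solver

-- The real part of the product is re² + im², so both squares are null, and hence so are both parts.
conj*≈0⇒≈0 : ∀ {z} → conj z * z ≈ 0ℂ → z ≈ 0ℂ
conj*≈0⇒≈0 {z} zz≈0 = mk≈ (square≈0 {re z} (Null-sumˡ (seq re²) (seq im²) re²≥0 im²≥0 re²+im²))
  (square≈0 {im z} (Null-sumˡ (seq im²) (seq re²) im²≥0 re²≥0 (Null-resp-≗ (λ n → ℚ.+-comm (seq re² n) (seq im² n)) re²+im²)))
  where
  re² = re z Real.* re z
  im² = im z Real.* im z
  re²≥0 = λ n → p²≥0 (seq (re z) n)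
  im²≥0 = λ n → p²≥0 (seq (im z) n)

  re²+im² : Null (λ n → seq re² n ℚ.+ seq im² n)
  re²+im² = Null-resp-≗
    (λ n → ≡.trans (ℚ.+-identityʳ _) (normSq-re (seq (re z) n) (seq (im z) n)))
    (null (re-≈ zz≈0))

  square≈0 : ∀ {r} → Null (λ n → seq r n ℚ.* seq r n) → r Real.≈ Real.fromℚ 0ℚ
  square≈0 {r} r²null = Real.mk≈
    (Null-resp-≗ (λ n → ≡.sym (ℚ.+-identityʳ (seq r n))) (Null-square r²null))

∑conj*≈0⇒≈0 : ∀ {n} (v : Vector ℂ n) → ∑ (λ a → conj (v a) * v a) ≈ 0ℂ → v ≈ᵛ 0ᵛ
∑conj*≈0⇒≈0 v ∑≈0 a =
  conj*≈0⇒≈0 (∑-nonNegative-zero {v = λ a → conj (v a) * v a} (λ a → conj*-nonNegative (v a)) ∑≈0 a)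

-- Orthogonal projections

infix 9 _ᴴ

_ᴴ : ∀ {m n} → Matrix m n → Matrix n m
(M ᴴ) a b = conj (M b a)

-- Equivalent to M being Hermitian and idempotent.
IsProjection : ∀ {n} → Matrix n n → Set
IsProjection M = M ᴴ *ᴹ M ≈ᴹ M

-- Covers the indices outside an orbit, where the sum defining `orbitIdempotent` has a zero matrix.
0ᴹ-isProjection : ∀ {n} → IsProjection (0ᴹ {n} {n})
0ᴹ-isProjection {n} a b = ∑-zero {n} (λ _ → conj 0ℂ * 0ℂ) λ _ → zeroʳ (conj 0ℂ)

ᴴ*-hermitian : ∀ {m n} (M : Matrix m n) a b → conj ((M ᴴ *ᴹ M) b a) ≈ (M ᴴ *ᴹ M) a b
ᴴ*-hermitian M a b = trans (conj-∑ (λ c → conj (M c b) * M c a)) (sum-cong-≋ λ c →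
  trans (conj-* (conj (M c b)) (M c a))
  (trans (*-congʳ (conj-involutive (M c b))) (*-comm (M c b) (conj (M c a)))))

-- D = M − MᴴM is orthogonal to the range of M, yet is itself a multiple of M;
-- hence DᴴD = 0 and D = 0.
idempotent⇒isProjection : ∀ {n} (M : Matrix n n) c → M *ᴹ M ≈ᴹ M →
                          M ᴴ *ᴹ M ≈ᴹ c •ᴹ M → IsProjection M
idempotent⇒isProjection {n} M c M²≈M P≈cM a b = begin
  P a b                     ≈⟨ +-identityˡ (P a b) ⟨
  0ℂ + P a b                ≈⟨ +-cong (D≈0 a b) refl ⟨
  M a b + - P a b + P a b   ≈⟨ +-assoc (M a b) (- P a b) (P a b) ⟩
  M a b + (- P a b + P a b) ≈⟨ +-congˡ (-‿inverseˡ (P a b)) ⟩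
  M a b + 0ℂ                ≈⟨ +-identityʳ (M a b) ⟩
  M a b                     ∎
  where
  open ≈-Reasoning
  P D : Matrix n n
  P = M ᴴ *ᴹ M
  D a b = M a b + - P a b

  D≈multiple : ∀ a b → D a b ≈ (1ℂ + - c) * M a b
  D≈multiple a b = begin
    M a b + - P a b             ≈⟨ +-cong (*-identityˡ (M a b)) (-‿cong (sym (P≈cM a b))) ⟨
    1ℂ * M a b + - (c * M a b)  ≈⟨ +-congˡ (-‿distribˡ-* c (M a b)) ⟩
    1ℂ * M a b + - c * M a b    ≈⟨ distribʳ (M a b) 1ℂ (- c) ⟨
    (1ℂ + - c) * M a b          ∎

  PM≈P : ∀ a b → (P *ᴹ M) a b ≈ P a b
  PM≈P a b = trans (sym (∑-assoc (λ c → conj (M c a)) M (λ c → M c b)))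
    (sum-cong-≋ λ c → *-congˡ (M²≈M c b))

  -- Since P is Hermitian, DᴴM = MᴴM - PM = P - PM, which vanishes by `PM≈P`.
  DᴴM≈0 : ∀ a b → (D ᴴ *ᴹ M) a b ≈ 0ℂ
  DᴴM≈0 a b = begin
    ∑ (λ c → conj (D c a) * M c b)
      ≈⟨ sum-cong-≋ (λ c → *-congʳ {M c b} (trans (conj-+ (M c a) (- P c a)) (+-congˡ (conj-neg (P c a))))) ⟩
    ∑ (λ c → (conj (M c a) + - conj (P c a)) * M c b)
      ≈⟨ sum-cong-≋ (λ c → *-congʳ {M c b} (+-congˡ (-‿cong (ᴴ*-hermitian M a c)))) ⟩
    ∑ (λ c → (conj (M c a) + - P a c) * M c b)
      ≈⟨ sum-cong-≋ (λ c → distribʳ (M c b) (conj (M c a)) (- P a c)) ⟩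
    ∑ (λ c → conj (M c a) * M c b + - P a c * M c b)
      ≈⟨ ∑-distrib-+ (λ c → conj (M c a) * M c b) (λ c → - P a c * M c b) ⟩
    P a b + ∑ (λ c → - P a c * M c b)
      -- Negation is turned into the scalar -1 so that distributivity can pull it out of the sum.
      ≈⟨ +-congˡ (sum-cong-≋ λ c → trans (sym (-‿distribˡ-* (P a c) (M c b))) (neg≈-1* (P a c * M c b))) ⟩
    P a b + ∑ (λ c → - 1ℂ * (P a c * M c b))
      ≈⟨ +-congˡ (*-distribˡ-sum (- 1ℂ) (λ c → P a c * M c b)) ⟨
    P a b + - 1ℂ * (P *ᴹ M) a b
      ≈⟨ +-congˡ (trans (*-congˡ (PM≈P a b)) (sym (neg≈-1* (P a b)))) ⟩
    P a b + - P a b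
      ≈⟨ -‿inverseʳ (P a b) ⟩
    0ℂ ∎
    where
    neg≈-1* : ∀ z → - z ≈ - 1ℂ * z
    neg≈-1* z = trans (-‿cong (sym (*-identityˡ z))) (-‿distribˡ-* 1ℂ z)

  D≈0 : D ≈ᴹ 0ᴹ
  -- The squared norm of column `b` of D is a diagonal entry of DᴴD; writing the right factor as (1
  -- - c)M turns it into a multiple of the same entry of DᴴM.
  D≈0 a b = ∑conj*≈0⇒≈0 (λ c → D c b) (begin
    ∑ (λ e → conj (D e b) * D e b)
      ≈⟨ sum-cong-≋ (λ e → trans (*-congˡ (D≈multiple e b)) (*-left-comm (conj (D e b)) (1ℂ + - c) (M e b))) ⟩
    ∑ (λ e → (1ℂ + - c) * (conj (D e b) * M e b))
      ≈⟨ *-distribˡ-sum (1ℂ + - c) (λ e → conj (D e b) * M e b) ⟨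
    (1ℂ + - c) * (D ᴴ *ᴹ M) b b
      ≈⟨ *-congˡ (DᴴM≈0 b b) ⟩
    (1ℂ + - c) * 0ℂ
      ≈⟨ zeroʳ (1ℂ + - c) ⟩
    0ℂ ∎) a

-- Quadratic forms xᵀMx at a rational vector x

module QuadraticForm {n : ℕ} (x : Vector ℚ n) where

  private
    y : Vector ℂ n
    y = ⟨ x ⟩ᵛ

  form : Matrix n n → ℂ
  form M = ∑ λ a → ⟨ x a ⟩ * (M *ᵛ ⟨ x ⟩ᵛ) a

  *ᵛ-congˡ : ∀ {M N : Matrix n n} → M ≈ᴹ N → M *ᵛ ⟨ x ⟩ᵛ ≈ᵛ N *ᵛ ⟨ x ⟩ᵛ
  *ᵛ-congˡ M≈N a = sum-cong-≋ λ b → *-congʳ (M≈N a b)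

  form-cong : ∀ {M N} → M ≈ᴹ N → form M ≈ form N
  form-cong M≈N = sum-cong-≋ λ a → *-congˡ (*ᵛ-congˡ M≈N a)

  form-•ᴹ : ∀ c M → form (c •ᴹ M) ≈ c * form M
  form-•ᴹ c M = trans
    (sum-cong-≋ λ a → trans (*-congˡ (•ᴹ-*ᵛ c M ⟨ x ⟩ᵛ a)) (*-left-comm ⟨ x a ⟩ c _))
    (sym (*-distribˡ-sum c λ a → ⟨ x a ⟩ * (M *ᵛ ⟨ x ⟩ᵛ) a))

  form-∑ᴹ : ∀ {k} (B : Fin k → Matrix n n) → form (∑ᴹ B) ≈ ∑ (λ i → form (B i))
  form-∑ᴹ B = trans
    (sum-cong-≋ λ a → trans (*-congˡ (∑ᴹ-*ᵛ B ⟨ x ⟩ᵛ a)) (*-distribˡ-sum ⟨ x a ⟩ λ i → (B i *ᵛ ⟨ x ⟩ᵛ) a))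
    (∑-comm λ a i → ⟨ x a ⟩ * (B i *ᵛ ⟨ x ⟩ᵛ) a)

  form-zero : ∀ M → M *ᵛ ⟨ x ⟩ᵛ ≈ᵛ 0ᵛ → form M ≈ 0ℂ
  form-zero M Mx≈0 = ∑-zero _ λ a → trans (*-congˡ (Mx≈0 a)) (zeroʳ ⟨ x a ⟩)

  form-⟨⟩ᴹ : ∀ (M : Fin n → Fin n → ℚ) → ⟨ dot x (λ a → dot (M a) x) ⟩ ≈ form ⟨ M ⟩ᴹ
  form-⟨⟩ᴹ M = trans (⟨⟩-dot x (λ a → dot (M a) x)) (sum-cong-≋ λ a → *-congˡ (⟨⟩-dot (M a) x))

  -- Replacing M by MᴴM turns xᵀMx into (Mx)ᴴ(Mx), the squared norm of Mx.
  form-isProjection : ∀ {M} → IsProjection M →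
    form M ≈ ∑ (λ a → conj ((M *ᵛ ⟨ x ⟩ᵛ) a) * (M *ᵛ ⟨ x ⟩ᵛ) a)
  form-isProjection {M} MᴴM≈M = begin
    ∑ (λ a → y a * (M *ᵛ y) a)
      ≈⟨ sum-cong-≋ (λ a → *-congˡ {y a} (*ᵛ-congˡ (λ a b → sym (MᴴM≈M a b)) a)) ⟩
    ∑ (λ a → y a * ((M ᴴ *ᴹ M) *ᵛ y) a)
      ≈⟨ sum-cong-≋ (λ a → *-congˡ {y a} (sym (∑-assoc ((M ᴴ) a) M y))) ⟩
    ∑ (λ a → y a * (M ᴴ *ᵛ (M *ᵛ y)) a)
      ≈⟨ ∑-assoc y (M ᴴ) (M *ᵛ y) ⟩
    ∑ (λ c → (y ᵛ* M ᴴ) c * (M *ᵛ y) c)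
      ≈⟨ sum-cong-≋ (λ c → *-congʳ {(M *ᵛ y) c} (xᵀMᴴ c)) ⟩
    ∑ (λ c → conj ((M *ᵛ y) c) * (M *ᵛ y) c) ∎
    where
    open ≈-Reasoning
    -- Rationality of `x` enters here: conjugation fixes its entries.
    xᵀMᴴ : ∀ c → (y ᵛ* M ᴴ) c ≈ conj ((M *ᵛ y) c)
    xᵀMᴴ c = sym (trans (conj-∑ λ a → M c a * ⟨ x a ⟩) (sum-cong-≋ λ a →
      trans (conj-* (M c a) ⟨ x a ⟩) (trans (*-congˡ (conj-⟨⟩ (x a))) (*-comm _ _))))

  form-nonNegative : ∀ {M} → IsProjection M → NonNegative (form M)
  form-nonNegative {M} proj = NonNegative-resp-≈ (sym (form-isProjection proj))
    (NonNegative-∑ λ a → conj*-nonNegative ((M *ᵛ ⟨ x ⟩ᵛ) a))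

  form≈0⇒*ᵛ≈0 : ∀ {M} → IsProjection M → form M ≈ 0ℂ → M *ᵛ ⟨ x ⟩ᵛ ≈ᵛ 0ᵛ
  form≈0⇒*ᵛ≈0 {M} proj form≈0 =
    ∑conj*≈0⇒≈0 (M *ᵛ ⟨ x ⟩ᵛ) (trans (sym (form-isProjection proj)) form≈0)

-- Galois conjugation

module _ {S : Pred ℂ 0ℓ} (𝛔 : Gal S) where
  open Gal 𝛔
  open RingMorphisms (ℚ⟮⟯-rawRing S) (ℚ⟮⟯-rawRing S) using (module IsRingIsomorphism)
  open IsRingIsomorphism isRingIsomorphism using (+-homo; *-homo; ⟦⟧-cong)

  -- The membership proof is existential, as in `Σℚ`, because `fun` acts on pairs; a sum of related
  -- numbers then supplies its own proof.
  Maps : ℂ → ℂ → Set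
  Maps z w = ∃ λ (m : z ∈ ℚ⟮ S ⟯) → proj₁ (fun (z , m)) ≈ w

  -- The automorphism respects sums and products and fixes each rational weight; applied to a row of
  -- E_j, this follows one entry of E_j x.
  Maps-∑ : ∀ {n} (x : Vector ℚ n) (u v : Vector ℂ n) → (∀ b → Maps (u b) (v b)) →
           Maps (∑ λ b → u b * ⟨ x b ⟩) (∑ λ b → v b * ⟨ x b ⟩)
  Maps-∑ {ℕ.zero} x u v u↦v = rational 0ℚ , fixes-ℚ 0ℚ
  Maps-∑ {suc n}  x u v u↦v =
    let (m , eq)   = u↦v zero
        (m′ , eq′) = Maps-∑ (x ∘ suc) (u ∘ suc) (v ∘ suc) (u↦v ∘ suc)
    in sum-mem (prod-mem m (rational (x zero))) m′ ,
       trans (+-homo _ _) (+-cong (trans (*-homo _ _) (*-cong eq (fixes-ℚ (x zero)))) eq′)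

  -- Equality in the field compares complex numbers only, so `z` may be replaced by the rational 0,
  -- which is fixed.
  Maps-0 : ∀ {z w} → Maps z w → z ≈ 0ℂ → w ≈ 0ℂ
  Maps-0 (m , eq) z≈0 = trans (sym eq) (trans (⟦⟧-cong z≈0) (fixes-ℚ 0ℚ))

-- Idempotents and designs of a scheme

module Scheme {d : ℕ} (𝔛 : AssociationScheme d) where
  open AssociationScheme 𝔛

  A-rel : ∀ a b → A (rel a b) a b ≡ 1ℚ
  A-rel a b = cong (if_then 1ℚ else 0ℚ) (dec-true (rel a b ≟ rel a b) ≡.refl)

  A-¬rel : ∀ i a b → i ≢ rel a b → A i a b ≡ 0ℚ
  A-¬rel i a b i≢rel = cong (if_then 1ℚ else 0ℚ) (dec-false (rel a b ≟ i) (i≢rel ∘ ≡.sym))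

  -- Each pair lies in exactly one class, so a single term survives: the span consists of the
  -- matrices constant on classes.
  ∑-Aℂ : ∀ (c : Vector ℂ (suc d)) a b → ∑ᴹ (λ i → c i •ᴹ Aℂ i) a b ≈ c (rel a b)
  ∑-Aℂ c a b = begin
    ∑ (λ i → c i * Aℂ i a b)      ≈⟨ ∑-single _ (rel a b) (λ i i≢rel →
                                       trans (*-congˡ (reflexive (cong ⟨_⟩ (A-¬rel i a b i≢rel)))) (zeroʳ (c i))) ⟩
    c (rel a b) * Aℂ (rel a b) a b ≈⟨ *-congˡ (reflexive (cong ⟨_⟩ (A-rel a b))) ⟩
    c (rel a b) * 1ℂ              ≈⟨ *-identityʳ (c (rel a b)) ⟩
    c (rel a b)                   ∎
    where open ≈-Reasoning

  Span-Aℂ-ᴴ : ∀ {M} → M ∈ Span Aℂ → M ᴴ ∈ Span Aℂ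
  Span-Aℂ-ᴴ {M} (c , M≈) = c′ , λ a b → begin
    conj (M b a)                     ≈⟨ conj-cong (trans (M≈ b a) (∑-Aℂ c b a)) ⟩
    conj (c (rel b a))               ≈⟨ reflexive (cong (conj ∘ c) (rel-swap a b)) ⟩
    c′ (rel a b)                     ≈⟨ ∑-Aℂ c′ a b ⟨
    ∑ᴹ (λ i → c′ i •ᴹ Aℂ i) a b      ∎
    where
    open ≈-Reasoning
    c′ : Vector ℂ (suc d)
    -- If (a, b) lies in class i, then (b, a) lies in the transposed class, whose coefficient
    -- governs the entry of M there.
    c′ i = conj (c (proj₁ (rel-transpose i)))

    rel-swap : ∀ a b → rel b a ≡ proj₁ (rel-transpose (rel a b))
    rel-swap a b = Equivalence.to (proj₂ (rel-transpose (rel a b)) b a) ≡.refl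

  -- Primitive idempotents as orthogonal projections

  module Basis {E : Fin (suc d) → Matrix size size} (basis : IsPrimitiveIdempotentBasis 𝔛 E) where
    open IsPrimitiveIdempotentBasis basis

    -- The conjugate transpose of E_j is again in the span, so it expands as a combination of the
    -- E_k with coefficients e_k. Right multiplication by E_j removes all terms but e_j E_j, which
    -- is the hypothesis of `idempotent⇒isProjection`.
    E-isProjection : ∀ j → IsProjection (E j)
    E-isProjection j = idempotent⇒isProjection (E j) (e j) (idempotent j) EᴴE≈eE
      where
      open ≈-Reasoning
      Eᴴ∈SpanE = spanning (E j ᴴ) (Span-Aℂ-ᴴ (in-span j))
      e = proj₁ Eᴴ∈SpanE

      EᴴE≈eE : E j ᴴ *ᴹ E j ≈ᴹ e j •ᴹ E j
      EᴴE≈eE a b = begin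
        ∑ (λ c → (E j ᴴ) a c * E j c b)                  ≈⟨ sum-cong-≋ (λ c → *-congʳ {E j c b} (proj₂ Eᴴ∈SpanE a c)) ⟩
        ∑ (λ c → ∑ (λ k → e k * E k a c) * E j c b)      ≈⟨ ∑-assoc e (λ k c → E k a c) (λ c → E j c b) ⟨
        ∑ (λ k → e k * (E k *ᴹ E j) a b)                 ≈⟨ ∑-single (λ k → e k * (E k *ᴹ E j) a b) j (λ k k≢j →
                                                              trans (*-congˡ (orthogonal k j k≢j a b)) (zeroʳ (e k))) ⟩
        e j * (E j *ᴹ E j) a b                           ≈⟨ *-congˡ (idempotent j a b) ⟩
        e j * E j a b                                    ∎

  -- Design indices and Galois orbits

  module Design (E : Fin (suc d) → Matrix size size) (x : Vector ℚ size) where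

    T : Pred (Fin (suc d)) 0ℓ
    T = DesignIndices 𝔛 E x

    T-Σℚ : ∀ j σ → j ∈ T → σ ∈ Σℚ 𝔛 E → (σ ⟨$⟩ʳ j) ∈ T
    T-Σℚ j σ j∈T (𝛔 , E↦E) a =
      Maps-0 𝛔 (Maps-∑ 𝛔 x (E j a) (E (σ ⟨$⟩ʳ j) a) (E↦E j a)) (j∈T a)

    T-orbit : ∀ {e} {ι : Fin (suc d) → Fin (suc e)} → IsOrbitIndex 𝔛 E ι →
              ∀ i j → ι i ≡ ι j → i ∈ T → j ∈ T
    T-orbit orbitIndex i j ιi≡ιj i∈T =
      let (σ , σ∈Σ , σi≡j) = Equivalence.to (IsOrbitIndex.orbits orbitIndex i j) ιi≡ιj
      in subst (_∈ T) σi≡j (T-Σℚ i σ i∈T σ∈Σ)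

    1/∣X∣-nonZero : ℚ.NonZero 1/∣X∣
    1/∣X∣-nonZero = ℚ.pos⇒nonZero 1/∣X∣ {{ℚ.normalize-pos 1 size {{nonEmpty}}}}

    -- Every entry of E₀ x is the sum of `x` divided by |X|.
    zero∉T : IsPrimitiveIdempotentBasis 𝔛 E → ∑ℚ x ≢ 0ℚ → zero ∉ T
    zero∉T basis ∑x≢0 0∈T = ∑x≢0 (⟨⟩≈0⇒≡0 (⟨⟩*≈0⇒≈0 1/∣X∣ {{1/∣X∣-nonZero}} t∑x≈0))
      where
      -- The identity class is nonempty, which supplies a point of X and so a row of E₀.
      a = proj₁ (rel-onto zero)
      t∑x≈0 : ⟨ 1/∣X∣ ⟩ * ⟨ ∑ℚ x ⟩ ≈ 0ℂ
      t∑x≈0 = trans (*-congˡ (⟨⟩-∑ x)) (trans (*-distribˡ-sum ⟨ 1/∣X∣ ⟩ ⟨ x ⟩ᵛ)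
        (trans (sum-cong-≋ λ b → *-congʳ (sym (IsPrimitiveIdempotentBasis.E₀ basis a b))) (0∈T a)))

  -- Inner distribution and quadratic forms

  module Dual {E : Fin (suc d) → Matrix size size} (basis : IsPrimitiveIdempotentBasis 𝔛 E)
              (Q : Matrix (suc d) (suc d)) (eigen : IsSecondEigenmatrix 𝔛 E Q)
              (x : Vector ℚ size) (x≢0 : NonZeroVector x) where
    open Basis basis
    open Design E x
    open QuadraticForm x
    open ≈-Reasoning

    a : Vector ℂ (suc d)
    a = ⟨ innerDistribution 𝔛 x x≢0 ⟩ᵛ

    t s : ℂ
    t = ⟨ 1/∣X∣ ⟩
    s = ⟨ dot x x ⟩

    form-Aℂ : ∀ k → form (Aℂ k) ≈ s * a k
    form-Aℂ k = trans (sym (form-⟨⟩ᴹ (A k)))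
      (trans (reflexive (cong ⟨_⟩ cancel)) (⟨⟩-* (dot x x) (innerDistribution 𝔛 x x≢0 k)))
      where
      instance _ = dot-nonZero x x≢0
      N = dot x (λ a → dot (A k a) x)
      cancel : N ≡ dot x x ℚ.* (N ℚ.÷ dot x x)
      cancel = ≡.sym (≡.trans (ℚ.*-comm (dot x x) (N ℚ.÷ dot x x))
        (≡.trans (ℚ.*-assoc N (ℚ.1/ dot x x) (dot x x))
        (≡.trans (cong (N ℚ.*_) (ℚ.*-inverseˡ (dot x x))) (ℚ.*-identityʳ N))))

    form-E : ∀ i → form (E i) ≈ t * s * (a ᵛ* Q) i
    form-E i = begin
      form (E i)                                   ≈⟨ form-cong (eigen i) ⟩
      form (t •ᴹ ∑ᴹ (λ k → Q k i •ᴹ Aℂ k))         ≈⟨ form-•ᴹ t (∑ᴹ λ k → Q k i •ᴹ Aℂ k) ⟩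
      t * form (∑ᴹ (λ k → Q k i •ᴹ Aℂ k))          ≈⟨ *-congˡ (form-∑ᴹ λ k → Q k i •ᴹ Aℂ k) ⟩
      t * ∑ (λ k → form (Q k i •ᴹ Aℂ k))           ≈⟨ *-congˡ (sum-cong-≋ λ k → trans (form-•ᴹ (Q k i) (Aℂ k))
                                                        (trans (*-congˡ (form-Aℂ k)) (trans (*-left-comm (Q k i) s (a k))
                                                          (*-congˡ (*-comm (Q k i) (a k)))))) ⟩
      t * ∑ (λ k → s * (a k * Q k i))              ≈⟨ *-congˡ (*-distribˡ-sum s (λ k → a k * Q k i)) ⟨
      t * (s * (a ᵛ* Q) i)                         ≈⟨ *-assoc t s ((a ᵛ* Q) i) ⟨
      t * s * (a ᵛ* Q) i                           ∎

    ts*≈0⇒≈0 : ∀ {z} → t * s * z ≈ 0ℂ → z ≈ 0ℂ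
    ts*≈0⇒≈0 {z} tsz≈0 = ⟨⟩*≈0⇒≈0 (dot x x) {{dot-nonZero x x≢0}}
      (⟨⟩*≈0⇒≈0 1/∣X∣ {{1/∣X∣-nonZero}} (trans (sym (*-assoc t s z)) tsz≈0))

    -- By `form-E` the left side says xᵀE_i x = 0. Passing from there to E_i x = 0 uses definiteness
    -- of the norm; the converse is substitution.
    aQ≈0⇔T : ∀ i → (a ᵛ* Q) i ≈ 0ℂ ⇔ i ∈ T
    aQ≈0⇔T i = mk⇔
      (λ aQ≈0 → form≈0⇒*ᵛ≈0 (E-isProjection i) (trans (form-E i) (trans (*-congˡ aQ≈0) (zeroʳ (t * s)))))
      (λ i∈T → ts*≈0⇒≈0 (trans (sym (form-E i)) (form-zero (E i) i∈T)))

    -- Orbit idempotents and the columns of `Q̄`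

    module Orbits {e : ℕ} (ι : Fin (suc d) → Fin (suc e)) (ℓ : Fin (suc e)) where

      F : Matrix size size
      F = orbitIdempotent E ι ℓ

      Q̄ : Matrix (suc d) (suc e)
      Q̄ = Q *ᴹ orbitMatrix ι

      summand : Fin (suc d) → Matrix size size
      summand i = if does (ι i ≟ ℓ) then E i else 0ᴹ

      summand-isProjection : ∀ i → IsProjection (summand i)
      summand-isProjection i with does (ι i ≟ ℓ)
      ... | true  = E-isProjection i
      ... | false = 0ᴹ-isProjection

      0ᴹ*ᵛ : (0ᴹ {size} {size}) *ᵛ ⟨ x ⟩ᵛ ≈ᵛ 0ᵛ
      0ᴹ*ᵛ a = ∑-zero (λ b → 0ℂ * ⟨ x b ⟩) λ b → zeroˡ ⟨ x b ⟩

      F*ᵛ≈0 : (∀ i → summand i *ᵛ ⟨ x ⟩ᵛ ≈ᵛ 0ᵛ) → F *ᵛ ⟨ x ⟩ᵛ ≈ᵛ 0ᵛ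
      F*ᵛ≈0 all≈0 a = trans (∑ᴹ-*ᵛ summand ⟨ x ⟩ᵛ a) (∑-zero _ λ i → all≈0 i a)

      T⊇orbit⇒F*ᵛ≈0 : (∀ i → ι i ≡ ℓ → i ∈ T) → F *ᵛ ⟨ x ⟩ᵛ ≈ᵛ 0ᵛ
      T⊇orbit⇒F*ᵛ≈0 orbit⊆T = F*ᵛ≈0 summand≈0
        where
        summand≈0 : ∀ i → summand i *ᵛ ⟨ x ⟩ᵛ ≈ᵛ 0ᵛ
        summand≈0 i with ι i ≟ ℓ
        ... | yes ιi≡ℓ = orbit⊆T i ιi≡ℓ
        ... | no  _    = 0ᴹ*ᵛ

      form-summand : ∀ i → form (summand i) ≈ t * s * ((a ᵛ* Q) i * orbitMatrix ι i ℓ)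
      form-summand i with does (ι i ≟ ℓ)
      ... | true  = trans (form-E i) (*-congˡ (sym (*-identityʳ ((a ᵛ* Q) i))))
      ... | false = trans (form-zero 0ᴹ 0ᴹ*ᵛ)
                      (sym (trans (*-congˡ (zeroʳ ((a ᵛ* Q) i))) (zeroʳ (t * s))))

      -- Column ℓ of the orbit matrix selects the orbit, so adding up `form-E` over it gives (aQ)O,
      -- reassociated as a(QO).
      form-F : form F ≈ t * s * (a ᵛ* Q̄) ℓ
      form-F = begin
        form F
          ≈⟨ form-∑ᴹ summand ⟩
        ∑ (λ i → form (summand i))
          ≈⟨ sum-cong-≋ form-summand ⟩
        ∑ (λ i → t * s * ((a ᵛ* Q) i * orbitMatrix ι i ℓ))
          ≈⟨ *-distribˡ-sum (t * s) (λ i → (a ᵛ* Q) i * orbitMatrix ι i ℓ) ⟨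
        t * s * ∑ (λ i → (a ᵛ* Q) i * orbitMatrix ι i ℓ)
          ≈⟨ *-congˡ (∑-assoc a Q (λ i → orbitMatrix ι i ℓ)) ⟨
        t * s * (a ᵛ* Q̄) ℓ ∎

      -- The form of F is a sum of nonnegative forms of projections. If it vanishes, each summand
      -- already annihilates `x`, and hence F does.
      aQ̄≈0⇔F*ᵛ≈0 : (a ᵛ* Q̄) ℓ ≈ 0ℂ ⇔ F *ᵛ ⟨ x ⟩ᵛ ≈ᵛ 0ᵛ
      aQ̄≈0⇔F*ᵛ≈0 = mk⇔
        (λ aQ̄≈0 → F*ᵛ≈0 λ i → form≈0⇒*ᵛ≈0 (summand-isProjection i)
          (∑-nonNegative-zero (λ k → form-nonNegative (summand-isProjection k))
            (trans (sym (form-∑ᴹ summand)) (trans form-F (trans (*-congˡ aQ̄≈0) (zeroʳ (t * s))))) i))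
        (λ Fx≈0 → ts*≈0⇒≈0 (trans (sym form-F) (form-zero F Fx≈0)))

theorem4p1 :
  ∀ {d : ℕ} (𝔛 : AssociationScheme d) → let open AssociationScheme 𝔛 in
  (E : Fin (suc d) → Matrix size size) → IsPrimitiveIdempotentBasis 𝔛 E →
  (Q : Matrix (suc d) (suc d)) → IsSecondEigenmatrix 𝔛 E Q →
  ∀ {e : ℕ} (ι : Fin (suc d) → Fin (suc e)) → IsOrbitIndex 𝔛 E ι →
  (x : Vector ℚ size) (x≢0 : NonZeroVector x) →
  let a = ⟨ innerDistribution 𝔛 x x≢0 ⟩ᵛ
      T = DesignIndices 𝔛 E x
      F = orbitIdempotent E ι
      Q̄ = Q *ᴹ orbitMatrix ι
  in
  -- (i)
  ( (∀ j σ → j ∈ T → σ ∈ Σℚ 𝔛 E → (σ ⟨$⟩ʳ j) ∈ T)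
  × (∃ λ (S : Pred (Fin (suc e)) 0ℓ) →
       (∀ j → j ∈ T ⇔ (∃ λ ℓ → ℓ ∈ S × j ∈ orbit ι ℓ))
       -- E₀ x = 0 exactly when the entries of x sum to 0
       × (∑ℚ x ≢ 0ℚ → zero ∉ S)) )
  ×
  -- (ii)
  ( (∀ i j → ι i ≡ ι j → (a ᵛ* Q) i ≈ 0ℂ → (a ᵛ* Q) j ≈ 0ℂ)
  × (∀ i j → ι i ≡ ι j → E i *ᵛ ⟨ x ⟩ᵛ ≈ᵛ 0ᵛ → E j *ᵛ ⟨ x ⟩ᵛ ≈ᵛ 0ᵛ)
  × (∀ i → (a ᵛ* Q) i ≈ 0ℂ ⇔ E i *ᵛ ⟨ x ⟩ᵛ ≈ᵛ 0ᵛ) )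
  ×
  -- (iii)
  ( (∀ i → (a ᵛ* Q) i ≈ 0ℂ → (a ᵛ* Q̄) (ι i) ≈ 0ℂ)
  × (∀ i → E i *ᵛ ⟨ x ⟩ᵛ ≈ᵛ 0ᵛ → F (ι i) *ᵛ ⟨ x ⟩ᵛ ≈ᵛ 0ᵛ)
  × (∀ ℓ → (a ᵛ* Q̄) ℓ ≈ 0ℂ ⇔ F ℓ *ᵛ ⟨ x ⟩ᵛ ≈ᵛ 0ᵛ) )
theorem4p1 𝔛 E basis Q eigen ι orbitIndex x x≢0 =
  ( T-Σℚ
  -- S collects the orbits that meet T; by `T-orbit` each of them lies inside T.
  , (λ ℓ → ∃ λ i → ι i ≡ ℓ × i ∈ T)
  , (λ j → mk⇔ (λ j∈T → ι j , (j , ≡.refl , j∈T) , ≡.refl)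
               (λ (ℓ , (i , ιi≡ℓ , i∈T) , ιj≡ℓ) → T-orbit orbitIndex i j (≡.trans ιi≡ℓ (≡.sym ιj≡ℓ)) i∈T))
  -- The orbit numbered 0 is {0}, so if it met T then 0 itself would be in T.
  , (λ ∑x≢0 (i , ιi≡0 , i∈T) →
       zero∉T basis ∑x≢0 (subst (_∈ T) (Equivalence.to (IsOrbitIndex.ι₀ orbitIndex i) ιi≡0) i∈T)) )
  , ( (λ i j ιi≡ιj aQᵢ≈0 → from (aQ≈0⇔T j) (T-orbit orbitIndex i j ιi≡ιj (to (aQ≈0⇔T i) aQᵢ≈0)))
    , T-orbit orbitIndex
    , aQ≈0⇔T )
  , ( (λ i aQᵢ≈0 → from (aQ̄≈0⇔F*ᵛ≈0 ι (ι i)) (T⇒F*ᵛ≈0 i (to (aQ≈0⇔T i) aQᵢ≈0)))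
    , T⇒F*ᵛ≈0
    , aQ̄≈0⇔F*ᵛ≈0 ι )
  where
  open Scheme 𝔛
  open Design E x
  open Dual basis Q eigen x x≢0
  open Orbits
  open Equivalence using (to; from)

  T⇒F*ᵛ≈0 : ∀ i → i ∈ T → orbitIdempotent E ι (ι i) *ᵛ ⟨ x ⟩ᵛ ≈ᵛ 0ᵛ
  T⇒F*ᵛ≈0 i i∈T = T⊇orbit⇒F*ᵛ≈0 ι (ι i) λ j ιj≡ιi → T-orbit orbitIndex i j (≡.sym ιj≡ιi) i∈T
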